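{- Let $\mathcal{S}_n$ be the number of triangles incident with the vertex $v_{n,1}$ in a uniformly random triangulation $\mathcal{T}_n$ of the regular $n$-gon $P_n$ (equivalently, for $n\geq 3$, $\mathcal{S}_n=\mathcal{D}_{n,1}+1$, where $\mathcal{D}_{n,1}$ is the number of diagonals of $\mathcal{T}_n$ incident with $v_{n,1}$), and let $g_n(z)=\mathbb{E}(z^{\mathcal{S}_n})$. Then: 1. For $n\ge 4$, $$g_n(z)=\frac{1}{C_{n-2}}\sum_{s=1}^{n-2}\frac{s\,(2n-s-5)!}{(n-s-2)!\,(n-2)!}\,z^s.$$ 2. $\mathbb{E}(\mathcal{S}_n)=\dfrac{3(n-2)}{n}$ for $n\ge 2$. 3. $\mathrm{Var}(\mathcal{S}_n)=\dfrac{2(2n-3)(n-2)(n-3)}{n^2(n+1)}$ for $n\ge 2$.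
   Context: $P_n$ has vertices $v_{n,1},\dots,v_{n,n}$ in cyclic order. A triangulation of $P_n$ is a set of $n-3$ noncrossing diagonals partitioning $P_n$ into $n-2$ triangles; there are $C_{n-2}$ of them, where $C_k=\frac{1}{k+1}\binom{2k}{k}$, and $\mathcal{T}_n$ is chosen uniformly among them. Equivalently, $\mathcal{S}_n=\sum_{\Delta\in\mathcal{T}_n}f_n(\Delta)$, where the weight of the triangle with vertices $v_{n,l},v_{n,j},v_{n,r}$, $l<j<r$, is $1$ if $l=1$ and $0$ otherwise. For $n=2$ the polygon is degenerate, with a single empty triangulation and $\mathcal{S}_2=0$. $z$ is a complex variable. -}

module Defs where

open import Algebra.Bundles using (CommutativeRing)
open import Algebra.Morphism.Structures using (module RingMorphisms)
import Algebra.Morphism.Construct.Identity as Identity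
import Algebra.Properties.Semiring.Exp as Exp
open import Data.Integer.Base using (+_)
open import Data.List.Base using (List; []; _∷_; _++_; map; foldr; filter; length; applyUpTo; cartesianProduct)
open import Data.List.Membership.Propositional using (_∈_)
open import Data.List.Relation.Unary.AllPairs using (AllPairs; allPairs?)
open import Data.Nat.Base as ℕ using (ℕ; zero; suc; _≤_; _<_; _∸_; z≤n; s≤s)
open import Data.Nat.Combinatorics using (_C_; nCk+nC[k+1]≡[n+1]C[k+1])
import Data.Nat.Properties as ℕ
open import Data.Product.Base using (_×_; _,_)
open import Data.Product.Properties using (≡-dec)
open import Data.Rational.Base as ℚ using (ℚ; 0ℚ; _/_)
import Data.Rational.Properties as ℚ
open import Data.Sum.Base using (_⊎_)
open import Level using (Level; _⊔_; 0ℓ) renaming (suc to lsuc)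
open import Relation.Binary.Definitions using (DecidableEquality)
open import Relation.Binary.PropositionalEquality using (_≡_; refl; subst)
open import Relation.Nullary using (¬_; Dec)
open import Relation.Nullary.Decidable using (_×-dec_; _⊎-dec_; ¬?)

import Data.List.Membership.DecPropositional as DecMembership

------------------------------------------------------------------------
-- Chords, diagonals and triangulations of the convex n-gon

-- The vertex vₙ,ᵢ is represented by its index i ∈ {1, …, n}.

vertices : ℕ → List ℕ
vertices n = applyUpTo suc n

-- The segment joining vₙ,ₐ and vₙ,ᵦ is represented by the pair (a , b)
-- with a < b.

Chord : Set
Chord = ℕ × ℕ

_≟ᶜ_ : DecidableEquality Chord
_≟ᶜ_ = ≡-dec ℕ._≟_ ℕ._≟_

open DecMembership _≟ᶜ_ using (_∈?_)

Side : ℕ → Chord → Set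
Side n (a , b) = b ≡ suc a ⊎ (a ≡ 1 × b ≡ n)

side? : ∀ n c → Dec (Side n c)
side? n (a , b) = (b ℕ.≟ suc a) ⊎-dec ((a ℕ.≟ 1) ×-dec (b ℕ.≟ n))

Diagonal : ℕ → Chord → Set
Diagonal n (a , b) = a < b × ¬ Side n (a , b)

diagonal? : ∀ n c → Dec (Diagonal n c)
diagonal? n (a , b) = (a ℕ.<? b) ×-dec ¬? (side? n (a , b))

diagonals : ℕ → List Chord
diagonals n = filter (diagonal? n) (cartesianProduct (vertices n) (vertices n))

-- Two chords meet in the interior of the polygon iff their endpoints
-- interleave, in one order or the other.

Interleave : Chord → Chord → Set
Interleave (a , b) (c , d) = a < c × c < b × b < d

interleave? : ∀ c d → Dec (Interleave c d)
interleave? (a , b) (c , d) = (a ℕ.<? c) ×-dec (c ℕ.<? b) ×-dec (b ℕ.<? d)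

NonCrossing : Chord → Chord → Set
NonCrossing c d = ¬ (Interleave c d ⊎ Interleave d c)

nonCrossing? : ∀ c d → Dec (NonCrossing c d)
nonCrossing? c d = ¬? (interleave? c d ⊎-dec interleave? d c)

-- The triangle with vertices vₙ,ₗ, vₙ,ⱼ, vₙ,ᵣ, where l < j < r.

Triangle : Set
Triangle = ℕ × ℕ × ℕ

Edge : ℕ → List Chord → Chord → Set
Edge n T c = Side n c ⊎ c ∈ T

edge? : ∀ n T c → Dec (Edge n T c)
edge? n T c = side? n c ⊎-dec (c ∈? T)

-- If the diagonals in T do not cross, none of them can enter a triangle
-- whose three edges are sides of the polygon or members of T (it would
-- cross an edge), so these triangles are exactly the triangular regions
-- into which T divides the polygon.

IsTriangle : ℕ → List Chord → Triangle → Set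
IsTriangle n T (l , j , r) =
  l < j × j < r × Edge n T (l , j) × Edge n T (j , r) × Edge n T (l , r)

isTriangle? : ∀ n T t → Dec (IsTriangle n T t)
isTriangle? n T (l , j , r) =
  (l ℕ.<? j) ×-dec (j ℕ.<? r) ×-dec
  edge? n T (l , j) ×-dec edge? n T (j , r) ×-dec edge? n T (l , r)

triangles : ℕ → List Chord → List Triangle
triangles n T =
  filter (isTriangle? n T)
    (cartesianProduct (vertices n) (cartesianProduct (vertices n) (vertices n)))

-- For T a set of diagonals: n ∸ 3 noncrossing diagonals divide the polygon
-- into n ∸ 2 regions, and the last condition says that all of these are
-- triangles.  For n ≡ 2 the truncated differences are 0, and the empty set
-- is the only triangulation.

IsTriangulation : ℕ → List Chord → Set
IsTriangulation n T =
  length T ≡ n ∸ 3 × AllPairs NonCrossing T × length (triangles n T) ≡ n ∸ 2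

isTriangulation? : ∀ n T → Dec (IsTriangulation n T)
isTriangulation? n T =
  (length T ℕ.≟ n ∸ 3) ×-dec allPairs? nonCrossing? T ×-dec
  (length (triangles n T) ℕ.≟ n ∸ 2)

-- A subset of a list without repetitions is represented by the sublist of
-- its elements, so each subset occurs exactly once.

subsets : ∀ {a} {A : Set a} → List A → List (List A)
subsets []       = [] ∷ []
subsets (x ∷ xs) = subsets xs ++ map (x ∷_) (subsets xs)

triangulations : ℕ → List (List Chord)
triangulations n = filter (isTriangulation? n) (subsets (diagonals n))

trianglesAt : ℕ → ℕ → List Chord → ℕ
trianglesAt v n T = length (filter incident? (triangles n T))
  where
  incident? : ∀ ((l , j , r) : Triangle) → Dec (v ≡ l ⊎ v ≡ j ⊎ v ≡ r)
  incident? (l , j , r) = (v ℕ.≟ l) ⊎-dec (v ℕ.≟ j) ⊎-dec (v ℕ.≟ r)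

diagonalsAt : ℕ → List Chord → ℕ
diagonalsAt v T = length (filter incident? T)
  where
  incident? : ∀ ((a , b) : Chord) → Dec (v ≡ a ⊎ v ≡ b)
  incident? (a , b) = (v ℕ.≟ a) ⊎-dec (v ℕ.≟ b)

𝒮 : ℕ → List Chord → ℕ
𝒮 = trianglesAt 1

𝒟₁ : List Chord → ℕ
𝒟₁ = diagonalsAt 1

------------------------------------------------------------------------
-- Commutative ℚ-algebras, in which the variable z takes its values: ℂ, which
-- the library does not provide, is one of them.

record ℚ-Algebra (c ℓ : Level) : Set (lsuc (c ⊔ ℓ)) where
  field
    commutativeRing : CommutativeRing c ℓ

  open CommutativeRing commutativeRing public
  open Exp semiring public using (_^_)

  field
    fromℚ               : ℚ → Carrier
    fromℚ-homomorphism  :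
      RingMorphisms.IsRingHomomorphism ℚ.+-*-rawRing rawRing fromℚ

  infixr 7 _•_

  _•_ : ℚ → Carrier → Carrier
  q • x = fromℚ q * x

  ∑ : ∀ {a} {A : Set a} → List A → (A → Carrier) → Carrier
  ∑ xs f = foldr _+_ 0# (map f xs)

ℚ-algebra : ℚ-Algebra 0ℓ 0ℓ
ℚ-algebra = record
  { commutativeRing    = ℚ.+-*-commutativeRing
  ; fromℚ              = λ q → q
  ; fromℚ-homomorphism = Identity.isRingHomomorphism ℚ.+-*-rawRing refl
  }

------------------------------------------------------------------------
-- Expectation under the uniform distribution on a finite list of outcomes

-- The value at 0 is irrelevant: it is used only for an empty list of
-- outcomes.

reciprocal : ℕ → ℚ
reciprocal zero    = 0ℚ
reciprocal (suc k) = + 1 / suc k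

module _ {c ℓ} (K : ℚ-Algebra c ℓ) where
  open ℚ-Algebra K

  𝔼 : ∀ {a} {A : Set a} → List A → (A → Carrier) → Carrier
  𝔼 Ω X = reciprocal (length Ω) • ∑ Ω X

  g : ℕ → Carrier → Carrier
  g n z = 𝔼 (triangulations n) (λ T → z ^ 𝒮 n T)

mean : ∀ {a} {A : Set a} → List A → (A → ℕ) → ℚ
mean Ω X = 𝔼 ℚ-algebra Ω (λ ω → + X ω / 1)

variance : ∀ {a} {A : Set a} → List A → (A → ℕ) → ℚ
variance Ω X = 𝔼 ℚ-algebra Ω (λ ω → deviation ω ℚ.* deviation ω)
  where deviation = λ ω → + X ω / 1 ℚ.- mean Ω X

------------------------------------------------------------------------
-- Catalan numbers

catalan : ℕ → ℚ
catalan k = + 1 / suc k ℚ.* (+ ((2 ℕ.* k) C k) / 1)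

nCk-nonZero : ∀ {n k} → k ≤ n → ℕ.NonZero (n C k)
nCk-nonZero {n}     {zero}  z≤n       = _
nCk-nonZero {suc n} {suc k} (s≤s k≤n) =
  subst ℕ.NonZero (nCk+nC[k+1]≡[n+1]C[k+1] n k)
    (ℕ.>-nonZero (ℕ.<-≤-trans (ℕ.>-nonZero⁻¹ (n C k) {{nCk-nonZero k≤n}})
                              (ℕ.m≤m+n (n C k) (n C suc k))))

catalan-nonZero : ∀ k → ℚ.NonZero (catalan k)
catalan-nonZero k = ℚ.pos⇒nonZero (catalan k) {{positive}}
  where
  b = (2 ℕ.* k) C k

  positive : ℚ.Positive (catalan k)
  positive = ℚ.pos*pos⇒pos
    (+ 1 / suc k) {{ℚ.normalize-pos 1 (suc k)}}
    (+ b / 1)     {{ℚ.normalize-pos b 1 {{_}} {{nCk-nonZero (ℕ.m≤m+n k _)}}}}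

1/catalan : ℕ → ℚ
1/catalan k = (ℚ.1/ catalan k) {{catalan-nonZero k}}

{-# OPTIONS --safe #-}

-- Cutting off the triangle on the side v₁vₙ recursively turns a triangulation of
-- the n-gon into a binary tree with n − 2 nodes, and the triangles at v₁ become the
-- nodes of the left spine.  To see that the n − 3 chords of a triangulation T do
-- come from a tree, note that a triangle is determined by its outer edge vₗvᵣ, a
-- member of T or v₁vₙ; as there are n − 2 triangles, each such edge is the outer edge
-- of one of them.  A tree with left spine of length s is a sequence of s trees, and
-- splitting the first tree of the sequence gives the recurrence
-- b(s+1, k+1) = b(s, k+1) + b(s+2, k) of the ballot numbers, hence their closed form.
-- The recurrence also makes the sums Σₛ b(s, m−s), Σₛ s b(s, m−s) and
-- Σₛ s(s+1) b(s, m−s) telescope to b(2, m−1), b(3, m−1) and 2b(4, m−1).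

module Submission where

open import Defs
open import Algebra.Morphism.Structures using (module RingMorphisms)
open import Data.Integer.Base as ℤ using (ℤ)
import Data.Integer.Properties as ℤ
import Data.Integer.Tactic.RingSolver as ℤ-Solver
open import Data.List.Base using (List; []; _∷_; _++_; map; filter; length; applyUpTo; cartesianProduct)
open import Data.List.Properties
  using ( length-++; length-map; map-∘; map-++; map-cong-local; ++-identityʳ
        ; filter-accept; filter-reject; filter-++; filter-none)
import Data.List.Membership.DecPropositional as DecMembership
open import Data.List.Membership.Propositional using (_∈_)
open import Data.List.Membership.Propositional.Properties
  using ( ∈-map⁺; ∈-map⁻; ∈-++⁺ˡ; ∈-++⁺ʳ; ∈-++⁻; ∈-∃++; ∈-filter⁺; ∈-filter⁻; ∈-AllPairs₂
        ; ∈-cartesianProduct⁺; ∈-cartesianProduct⁻; ∈-applyUpTo⁺; ∈-applyUpTo⁻)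
open import Data.List.Relation.Binary.Permutation.Propositional
  using (_↭_; ↭-refl; ↭-sym; ↭-trans; ↭-prep; ↭-reflexive; ↭⇒↭ₛ′)
open import Data.List.Relation.Binary.Permutation.Propositional.Properties
  using (∈-resp-↭; ↭-length; shift; filter-↭) renaming (map⁺ to map-↭)
open import Data.List.Relation.Binary.Permutation.Setoid.Properties using (foldr-commMonoid)
open import Data.List.Relation.Binary.Subset.Propositional using (_⊆_)
import Data.List.Relation.Unary.All as All
open import Data.List.Relation.Unary.All using (All; []; _∷_)
import Data.List.Relation.Unary.All.Properties as All
open import Data.List.Relation.Unary.AllPairs using (AllPairs; []; _∷_)
open import Data.List.Relation.Unary.Any using (here; there)
open import Data.List.Relation.Unary.Unique.Propositional using (Unique)
open import Data.List.Relation.Unary.Unique.Propositional.Properties as Unique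
  using (Unique[x∷xs]⇒x∉xs)
open import Data.Nat.Base as ℕ
  using (ℕ; zero; suc; _+_; _*_; _∸_; _!; _≤_; _<_; z≤n; s≤s; s<s; NonZero)
open import Data.Nat.Combinatorics using (_C_; nCk≡n!/k![n-k]!; k![n∸k]!∣n!)
open import Data.Nat.DivMod using (m/n*n≡m)
open import Data.Nat.ListAction using (sum)
open import Data.Nat.ListAction.Properties using (sum-++; sum-↭)
open import Data.Nat.Properties as ℕ
  using ( ≤-refl; ≤-trans; ≤-antisym; ≤-reflexive; <-trans; <-≤-trans; ≤-<-trans; <⇒≤; <-cmp; n≮n
        ; n<1+n; m≤m+n; m≤n+m; +-assoc; +-comm; +-identityʳ; +-suc; suc-injective; +-cancelˡ-≡
        ; m*n≢0; m^n≢0; _!*_!≢0)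
open import Data.Nat.Tactic.RingSolver using (solve-∀)
open import Data.Product.Base using (_×_; _,_; ∃; proj₁; proj₂)
open import Data.Rational.Base as ℚ using (ℚ; _/_; 0ℚ; 1ℚ; toℚᵘ)
import Data.Rational.Properties as ℚ
open import Data.Rational.Solver using (module +-*-Solver)
open import Data.Rational.Unnormalised.Base as ℚᵘ using (mkℚᵘ; *≡*)
import Data.Rational.Unnormalised.Properties as ℚᵘ
open import Data.Sum.Base using (_⊎_; inj₁; inj₂; [_,_]′)
open import Data.Vec.Base using (Vec; []; _∷_)
open import Function.Base using (_∘_)
open import Relation.Binary.Definitions using (tri<; tri≈; tri>)
open import Relation.Binary.PropositionalEquality
  using (_≡_; _≢_; refl; sym; trans; cong; cong₂; subst; subst₂; module ≡-Reasoning)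
import Relation.Binary.Reasoning.Setoid as SetoidReasoning
open import Relation.Nullary using (¬_; yes; no; contradiction)
open import Relation.Unary using (Pred; Decidable)

-- The definition picks triangulations out of all subsets of the diagonals by counting chords and
-- triangles; it has no recursive structure to follow. Where a reverse inclusion between two lists
-- of chords or triangles would call for planar geometry, it is obtained from the lengths of the
-- lists, so that the only geometry used is the comparison of endpoints. For the lengths to agree,
-- the side `(1 , n)` has to be put in front of `T`: then there is one chord for each of the `n ∸ 2`
-- triangles. The remaining sides, the steps `(b , suc b)`, correspond to the leaves of the tree.
-- The bijection does not respect the order in which triangulations and trees are listed. All that
-- is needed afterwards are sums, which are invariant under permutation.

open DecMembership _≟ᶜ_ using (_∈?_)

-- Lists without repetitions and their sublists

module _ {a} {A : Set a} where

  -- One copy of each entry of `xs` is taken out of `ys`. As `xs` has no repetitions, the entries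
  -- still to be found are different from those already removed.
  ⊆⇒↭-++ : {xs ys : List A} → Unique xs → xs ⊆ ys → ∃ λ zs → ys ↭ xs ++ zs
  ⊆⇒↭-++ {[]}     {ys} _            _     = ys , ↭-refl
  ⊆⇒↭-++ {x ∷ xs} {ys} x∷xs!@(_ ∷ xs!) x∷xs⊆ys with ∈-∃++ (x∷xs⊆ys (here refl))
  ... | us , vs , refl = let zs , p = ⊆⇒↭-++ xs! xs⊆us++vs in
    zs , ↭-trans (shift x us vs) (↭-prep x p)
    where
    xs⊆us++vs : xs ⊆ us ++ vs
    xs⊆us++vs y∈xs with ∈-resp-↭ (shift x us vs) (x∷xs⊆ys (there y∈xs))
    ... | here refl = contradiction y∈xs (Unique[x∷xs]⇒x∉xs x∷xs!)
    ... | there y∈  = y∈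

  ⊆⇒length≤ : {xs ys : List A} → Unique xs → xs ⊆ ys → length xs ≤ length ys
  ⊆⇒length≤ {xs} xs! xs⊆ys with ⊆⇒↭-++ xs! xs⊆ys
  ... | zs , p = subst (length xs ≤_)
    (sym (trans (↭-length p) (length-++ xs))) (m≤m+n (length xs) (length zs))

  -- Pigeonhole principle: the leftover `zs` has to be empty. This is what turns a count of
  -- triangles or chords into a reverse inclusion.
  ⊆∧length≥⇒↭ : {xs ys : List A} → Unique xs → xs ⊆ ys → length ys ≤ length xs → xs ↭ ys
  ⊆∧length≥⇒↭ {xs} xs! xs⊆ys ≥ with ⊆⇒↭-++ xs! xs⊆ys
  ... | []     , p = ↭-sym (↭-trans p (↭-reflexive (++-identityʳ xs)))
  ... | z ∷ zs , p = contradiction ≥ (ℕ.<⇒≱ (subst (length xs <_)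
    (sym (trans (↭-length p) (length-++ xs))) (ℕ.m<m+n (length xs) (s≤s z≤n))))

  ⊆∧⊇⇒↭ : {xs ys : List A} → Unique xs → Unique ys → xs ⊆ ys → ys ⊆ xs → xs ↭ ys
  ⊆∧⊇⇒↭ xs! ys! xs⊆ys ys⊆xs = ⊆∧length≥⇒↭ xs! xs⊆ys (⊆⇒length≤ ys! ys⊆xs)

  allPairs⁺ : ∀ {r} {R : A → A → Set r} {xs : List A} →
              (∀ {x y} → x ∈ xs → y ∈ xs → R x y) → AllPairs R xs
  allPairs⁺ {xs = []}     _ = []
  allPairs⁺ {xs = x ∷ xs} R = All.tabulate (λ y∈xs → R (here refl) (there y∈xs))
                            ∷ allPairs⁺ (λ x∈xs y∈xs → R (there x∈xs) (there y∈xs))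

  -- Injectivity is required on members of the list only, because `outer` and `treeDiagonals n` are
  -- not injective on their whole domains.
  unique-map : ∀ {b} {B : Set b} (f : A → B) {xs : List A} → Unique xs →
               (∀ {x y} → x ∈ xs → y ∈ xs → f x ≡ f y → x ≡ y) → Unique (map f xs)
  unique-map f []               _   = []
  unique-map f xs!@(_∷_ {x} {xs} _ xs!′) inj =
    All.tabulate fx∉ ∷ unique-map f xs!′ (λ x∈ y∈ → inj (there x∈) (there y∈))
    where
    fx∉ : ∀ {y} → y ∈ map f xs → f x ≢ y
    fx∉ y∈ fx≡y with ∈-map⁻ f y∈
    ... | x′ , x′∈ , refl with inj (here refl) (there x′∈) fx≡y
    ... | refl = Unique[x∷xs]⇒x∉xs xs! x′∈

  ∈-subsets⁻ : (xs : List A) {ys : List A} → ys ∈ subsets xs → ys ⊆ xs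
  ∈-subsets⁻ []       (here refl) ()
  ∈-subsets⁻ (x ∷ xs) ys∈ y∈ with ∈-++⁻ (subsets xs) ys∈
  ... | inj₁ ys∈′ = there (∈-subsets⁻ xs ys∈′ y∈)
  ... | inj₂ ys∈′ with ∈-map⁻ (x ∷_) ys∈′ | y∈
  ... | _ , _    , refl | here y≡x  = here y≡x
  ... | _ , zs∈ , refl | there y∈′ = there (∈-subsets⁻ xs zs∈ y∈′)

  subsets-unique : {xs : List A} → Unique xs → Unique (subsets xs)
  subsets-unique []          = [] ∷ []
  subsets-unique x∷xs!@(_∷_ {x} {xs} _ xs!) =
    Unique.++⁺ (subsets-unique xs!) (Unique.map⁺ (λ { refl → refl }) (subsets-unique xs!)) disjoint
    where
    disjoint : ∀ {ys} → ¬ (ys ∈ subsets xs × ys ∈ map (x ∷_) (subsets xs))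
    disjoint (ys∈ , ys∈′) with ∈-map⁻ (x ∷_) ys∈′
    ... | _ , _ , refl = Unique[x∷xs]⇒x∉xs x∷xs! (∈-subsets⁻ xs ys∈ (here refl))

  module _ {p} {P : Pred A p} (P? : Decidable P) where

    filter-∈-subsets : ∀ xs → filter P? xs ∈ subsets xs
    filter-∈-subsets []       = here refl
    filter-∈-subsets (x ∷ xs) with P? x
    ... | yes _ = ∈-++⁺ʳ (subsets xs) (∈-map⁺ (x ∷_) (filter-∈-subsets xs))
    ... | no  _ = ∈-++⁺ˡ (filter-∈-subsets xs)

    -- A member of `subsets xs` keeps the order of `xs`, so having the same elements as the filtered
    -- list makes it equal to that list, not just a permutation of it.
    filter-subset : ∀ {xs ys} → Unique xs → ys ∈ subsets xs →
                    (∀ {x} → x ∈ xs → P x → x ∈ ys) → (∀ {x} → x ∈ ys → P x) →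
                    filter P? xs ≡ ys
    filter-subset {[]}     _ (here refl) _ _ = refl
    filter-subset {x ∷ xs} {ys} x∷xs!@(_ ∷ xs!) ys∈ P⇒∈ ∈⇒P with ∈-++⁻ (subsets xs) ys∈
    ... | inj₁ ys∈′ = trans
      (filter-reject P? (λ Px → x∉xs (∈-subsets⁻ xs ys∈′ (P⇒∈ (here refl) Px))))
      (filter-subset xs! ys∈′ (P⇒∈ ∘ there) ∈⇒P)
      where x∉xs = Unique[x∷xs]⇒x∉xs x∷xs!
    ... | inj₂ ys∈′ with ∈-map⁻ (x ∷_) ys∈′
    ... | zs , zs∈ , refl = trans
      (filter-accept P? (∈⇒P (here refl)))
      (cong (x ∷_) (filter-subset xs! zs∈ P⇒∈′ (∈⇒P ∘ there)))
      where
      P⇒∈′ : ∀ {y} → y ∈ xs → P y → y ∈ zs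
      P⇒∈′ y∈ Py with P⇒∈ (there y∈) Py
      ... | here refl = contradiction y∈ (Unique[x∷xs]⇒x∉xs x∷xs!)
      ... | there y∈′ = y∈′

-- Binary trees

data Tree : Set where
  leaf : Tree
  node : Tree → Tree → Tree

nodes : Tree → ℕ
nodes leaf       = 0
nodes (node l r) = suc (nodes l + nodes r)

spine : Tree → ℕ
spine leaf       = 0
spine (node l r) = suc (spine l)

-- The leaves are the sides of the subpolygon other than its root edge; a tree placed at vertex `a`
-- thus spans the vertices from `a` to `a + size t`.
size : Tree → ℕ
size leaf       = 1
size (node l r) = size l + size r

size≡1+nodes : ∀ t → size t ≡ suc (nodes t)
size≡1+nodes leaf       = refl
size≡1+nodes (node l r) = trans (cong₂ _+_ (size≡1+nodes l) (size≡1+nodes r))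
                                (cong suc (+-suc (nodes l) (nodes r)))

0<size : ∀ t → 0 < size t
0<size t = subst (0 <_) (sym (size≡1+nodes t)) (s≤s z≤n)

a<a+size : ∀ a t → a < a + size t
a<a+size a t = ℕ.m<m+n a (0<size t)

triples : ℕ → Tree → List Triangle
triples a leaf       = []
triples a (node l r) =
  (a , a + size l , a + (size l + size r)) ∷ triples a l ++ triples (a + size l) r

-- The root edge is included, although for the whole polygon it is the side `(1 , n)`: this gives
-- exactly one chord per node.
chords : ℕ → Tree → List Chord
chords a leaf       = []
chords a (node l r) = (a , a + (size l + size r)) ∷ chords a l ++ chords (a + size l) r

length-triples : ∀ a t → length (triples a t) ≡ nodes t
length-triples a leaf       = refl
length-triples a (node l r) = cong suc (trans (length-++ (triples a l))
  (cong₂ _+_ (length-triples a l) (length-triples (a + size l) r)))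

length-chords : ∀ a t → length (chords a t) ≡ nodes t
length-chords a leaf       = refl
length-chords a (node l r) = cong suc (trans (length-++ (chords a l))
  (cong₂ _+_ (length-chords a l) (length-chords (a + size l) r)))

module _ (a : ℕ) (l r : Tree) where
  private j = a + size l

  ∈-chords⁻ : ∀ {c} → c ∈ chords a (node l r) →
              c ≡ (a , a + (size l + size r)) ⊎ c ∈ chords a l ⊎ c ∈ chords j r
  ∈-chords⁻ (here c≡)  = inj₁ c≡
  ∈-chords⁻ (there c∈) = inj₂ (∈-++⁻ (chords a l) c∈)

  ∈-chordsˡ : ∀ {c} → c ∈ chords a l → c ∈ chords a (node l r)
  ∈-chordsˡ c∈ = there (∈-++⁺ˡ c∈)

  ∈-chordsʳ : ∀ {c} → c ∈ chords j r → c ∈ chords a (node l r)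
  ∈-chordsʳ c∈ = there (∈-++⁺ʳ (chords a l) c∈)

-- The bound `suc l < r` says that no chord of a tree is a step; `long-edge` depends on it later.
chords-span : ∀ a t {l r} → (l , r) ∈ chords a t → a ≤ l × suc l < r × r ≤ a + size t
chords-span a (node t u) {r = r} c∈ with ∈-chords⁻ a t u c∈
... | inj₁ refl = ≤-refl
                , subst (_≤ a + (size t + size u)) (+-comm a 2)
                    (ℕ.+-monoʳ-≤ a (ℕ.+-mono-≤ (0<size t) (0<size u)))
                , ≤-refl
... | inj₂ (inj₁ c∈l) = let p , q , s = chords-span a t c∈l in
  p , q , ≤-trans s (ℕ.+-monoʳ-≤ a (m≤m+n (size t) (size u)))
... | inj₂ (inj₂ c∈r) = let p , q , s = chords-span (a + size t) u c∈r in
  ≤-trans (m≤m+n a (size t)) p , q , subst (r ≤_) (+-assoc a (size t) (size u)) s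

-- The root edge ends beyond the left subtree and starts before the right one, and the two subtrees
-- share only the apex.
chords-unique : ∀ a t → Unique (chords a t)
chords-unique a leaf       = []
chords-unique a (node t u) =
  All.tabulate root∉ ∷ Unique.++⁺ (chords-unique a t) (chords-unique (a + size t) u) disjoint
  where
  root∉ : ∀ {c} → c ∈ chords a t ++ chords (a + size t) u → (a , a + (size t + size u)) ≢ c
  root∉ c∈ refl with ∈-++⁻ (chords a t) c∈
  ... | inj₁ c∈t = let _ , _ , p = chords-span a t c∈t in
    n≮n (size t) (<-≤-trans (ℕ.m<m+n (size t) (0<size u)) (ℕ.+-cancelˡ-≤ a _ _ p))
  ... | inj₂ c∈u = let p , _ = chords-span (a + size t) u c∈u in
    n≮n a (<-≤-trans (a<a+size a t) p)

  disjoint : ∀ {c} → ¬ (c ∈ chords a t × c ∈ chords (a + size t) u)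
  disjoint (c∈t , c∈u) =
    let _ , l<r , r≤j = chords-span a t c∈t
        j≤l , _       = chords-span (a + size t) u c∈u
    in n≮n _ (<-≤-trans (<-trans (n<1+n _) l<r) (≤-trans r≤j j≤l))

chords-nonCrossing : ∀ a t {c d} → c ∈ chords a t → d ∈ chords a t → ¬ Interleave c d
chords-nonCrossing a (node t u) c∈ d∈ (p , q , s) with ∈-chords⁻ a t u c∈ | ∈-chords⁻ a t u d∈
... | inj₁ refl | _ =
  let _ , _ , r≤ = chords-span a (node t u) d∈ in n≮n _ (<-≤-trans s r≤)
... | inj₂ _ | inj₁ refl =
  let a≤ , _ = chords-span a (node t u) c∈ in n≮n _ (<-≤-trans p a≤)
... | inj₂ (inj₁ c∈t) | inj₂ (inj₁ d∈t) = chords-nonCrossing a t c∈t d∈t (p , q , s)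
... | inj₂ (inj₂ c∈u) | inj₂ (inj₂ d∈u) = chords-nonCrossing (a + size t) u c∈u d∈u (p , q , s)
... | inj₂ (inj₁ c∈t) | inj₂ (inj₂ d∈u) =
  let _ , _ , r≤ = chords-span a t c∈t
      ≤l , _     = chords-span (a + size t) u d∈u
  in n≮n _ (<-≤-trans q (≤-trans r≤ ≤l))
... | inj₂ (inj₂ c∈u) | inj₂ (inj₁ d∈t) =
  let _ , l<r , r≤ = chords-span a t d∈t
      ≤l , _       = chords-span (a + size t) u c∈u
  in n≮n _ (<-trans p (<-≤-trans (<-trans (n<1+n _) l<r) (≤-trans r≤ ≤l)))

outer : Triangle → Chord
outer (l , j , r) = l , r

-- Each triangle owns one chord, its outer edge. Uniqueness passes from chords to triangles along
-- this correspondence, and the count at vertex 1 from triangles to chords.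
map-outer-triples : ∀ a t → map outer (triples a t) ≡ chords a t
map-outer-triples a leaf       = refl
map-outer-triples a (node l r) = cong₂ _∷_ refl (trans (map-++ outer (triples a l) _)
  (cong₂ _++_ (map-outer-triples a l) (map-outer-triples (a + size l) r)))

triples-unique : ∀ a t → Unique (triples a t)
triples-unique a t = Unique.map⁻ (subst Unique (sym (map-outer-triples a t)) (chords-unique a t))

-- Sets of chords containing all steps (b , suc b)

module _ {e} {E : Chord → Set e} (step : ∀ b → E (b , suc b)) where

  -- A leaf has no chord of its own: its root edge is a step, and this is where the assumption on
  -- `E` enters.
  root-edge : ∀ a t → (∀ {c} → c ∈ chords a t → E c) → E (a , a + size t)
  root-edge a leaf       _ = subst (λ b → E (a , b)) (+-comm 1 a) (step a)
  root-edge a (node l r) E⊇ = E⊇ (here refl)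

  root-edgeʳ : ∀ a l r → (∀ {c} → c ∈ chords a (node l r) → E c) →
               E (a + size l , a + (size l + size r))
  root-edgeʳ a l r E⊇ = subst (λ b → E (a + size l , b)) (+-assoc a (size l) (size r))
    (root-edge (a + size l) r (E⊇ ∘ ∈-chordsʳ a l r))

  triples-edges : ∀ a t → (∀ {c} → c ∈ chords a t → E c) → ∀ {l j r} → (l , j , r) ∈ triples a t →
                  a ≤ l × l < j × j < r × r ≤ a + size t × E (l , j) × E (j , r) × E (l , r)
  triples-edges a (node t u) E⊇ (here refl) =
    ≤-refl , a<a+size a t , subst (a + size t <_) (+-assoc a (size t) (size u)) (a<a+size (a + size t) u) ,
    ≤-refl , root-edge a t (E⊇ ∘ ∈-chordsˡ a t u) , root-edgeʳ a t u E⊇ , E⊇ (here refl)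
  triples-edges a (node t u) E⊇ {r = r} (there τ∈) with ∈-++⁻ (triples a t) τ∈
  ... | inj₁ τ∈t = let p , q , s , v , es = triples-edges a t (E⊇ ∘ ∈-chordsˡ a t u) τ∈t in
    p , q , s , ≤-trans v (ℕ.+-monoʳ-≤ a (m≤m+n (size t) (size u))) , es
  ... | inj₂ τ∈u = let p , q , s , v , es = triples-edges (a + size t) u (E⊇ ∘ ∈-chordsʳ a t u) τ∈u in
    ≤-trans (m≤m+n a (size t)) p , q , s , subst (r ≤_) (+-assoc a (size t) (size u)) v , es

  module _ (nonCrossing : ∀ {c d} → E c → E d → ¬ Interleave c d) where

    -- If `j < j′`, the chords `(l , j′)` and `(j , r)` interleave; the other case is symmetric.
    apex-unique : ∀ {l j j′ r} → l < j → j < r → l < j′ → j′ < r →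
                  E (l , j) → E (j , r) → E (l , j′) → E (j′ , r) → j ≡ j′
    apex-unique {j = j} {j′} l<j j<r l<j′ j′<r lj jr lj′ j′r with <-cmp j j′
    ... | tri< j<j′ _ _ = contradiction (l<j , j<j′ , j′<r) (nonCrossing lj′ jr)
    ... | tri≈ _ j≡j′ _ = j≡j′
    ... | tri> _ _ j>j′ = contradiction (l<j′ , j>j′ , j<r) (nonCrossing lj j′r)

    -- Trees of equal size have the same root edge, and the apex over it is unique in `E`. Hence the
    -- left subtrees have equal sizes, so do the right ones, and the induction applies to both.
    tree-unique : ∀ a t t′ → size t ≡ size t′ →
                  (∀ {c} → c ∈ chords a t → E c) → (∀ {c} → c ∈ chords a t′ → E c) → t ≡ t′
    tree-unique a leaf leaf _ _ _ = refl
    tree-unique a leaf (node l r) size≡ _ _ =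
      contradiction size≡ (ℕ.<⇒≢ (ℕ.+-mono-≤ (0<size l) (0<size r)))
    tree-unique a (node l r) leaf size≡ _ _ =
      contradiction (sym size≡) (ℕ.<⇒≢ (ℕ.+-mono-≤ (0<size l) (0<size r)))
    tree-unique a (node l r) (node l′ r′) size≡ E⊇ E⊇′ = cong₂ node
      (tree-unique a l l′ l≡ (E⊇ ∘ ∈-chordsˡ a l r) (E⊇′ ∘ ∈-chordsˡ a l′ r′))
      (tree-unique (a + size l) r r′ r≡ (E⊇ ∘ ∈-chordsʳ a l r)
        (λ {c} c∈ → E⊇′ (∈-chordsʳ a l′ r′ (subst (λ s → c ∈ chords (a + s) r′) l≡ c∈))))
      where
      split : ∀ l r → a + size l < a + (size l + size r)
      split l r = subst (a + size l <_) (+-assoc a (size l) (size r)) (a<a+size (a + size l) r)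

      end≡ : a + (size l′ + size r′) ≡ a + (size l + size r)
      end≡ = cong (a +_) (sym size≡)

      l≡ : size l ≡ size l′
      l≡ = +-cancelˡ-≡ a _ _ (apex-unique (a<a+size a l) (split l r)
             (a<a+size a l′) (subst (a + size l′ <_) end≡ (split l′ r′))
             (root-edge a l (E⊇ ∘ ∈-chordsˡ a l r)) (root-edgeʳ a l r E⊇)
             (root-edge a l′ (E⊇′ ∘ ∈-chordsˡ a l′ r′))
             (subst (λ b → E (a + size l′ , b)) end≡ (root-edgeʳ a l′ r′ E⊇′)))

      r≡ : size r ≡ size r′
      r≡ = +-cancelˡ-≡ (size l) _ _ (trans size≡ (cong (_+ size r′) (sym l≡)))

    -- The apex splits an edge of length `suc (suc d)` into edges of lengths `suc x` and `suc y`
    -- with `d ≡ x + y`. Neither `x` nor `y` is structurally smaller than `suc d`, so `fuel` carries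
    -- the recursion.
    build : (∀ {l r} → suc l < r → E (l , r) → ∃ λ j → l < j × j < r × E (l , j) × E (j , r)) →
            ∀ fuel a d → d < fuel → E (a , a + suc d) →
            ∃ λ t → size t ≡ suc d × (∀ {c} → c ∈ chords a t → E c)
    build apex (suc fuel) a zero    _          _ = leaf , refl , λ ()
    build apex (suc fuel) a (suc d) (s≤s d<) e
      with apex (subst (suc a <_) (sym (+-suc a (suc d))) (s≤s (ℕ.m<m+n a (s≤s z≤n)))) e
    ... | j , a<j , j<r , aj , jr with ℕ.m≤n⇒∃[o]m+o≡n a<j | ℕ.m≤n⇒∃[o]m+o≡n j<r
    ... | x , refl | y , y≡ = node (proj₁ L) (proj₁ R) , size≡ , E⊇
      where
      j≡ : suc a + x ≡ a + suc x
      j≡ = sym (+-suc a x)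

      r≡ : a + suc (suc d) ≡ a + suc x + suc y
      r≡ = trans (sym y≡) (trans (sym (+-suc _ y)) (cong (_+ suc y) j≡))

      d≡ : suc (suc d) ≡ suc x + suc y
      d≡ = +-cancelˡ-≡ a _ _ (trans r≡ (+-assoc a (suc x) (suc y)))

      d≡′ : d ≡ x + y
      d≡′ = suc-injective (suc-injective (trans d≡ (cong suc (+-suc x y))))

      L = build apex fuel a x (≤-<-trans (subst (x ≤_) (sym d≡′) (m≤m+n x y)) d<)
            (subst (λ b → E (a , b)) j≡ aj)
      R = build apex fuel (a + suc x) y (≤-<-trans (subst (y ≤_) (sym d≡′) (m≤n+m y x)) d<)
            (subst₂ (λ b c → E (b , c)) j≡ r≡ jr)

      size≡ : size (proj₁ L) + size (proj₁ R) ≡ suc (suc d)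
      size≡ = trans (cong₂ _+_ (proj₁ (proj₂ L)) (proj₁ (proj₂ R))) (sym d≡)

      E⊇ : ∀ {c} → c ∈ chords a (node (proj₁ L) (proj₁ R)) → E c
      E⊇ {c} c∈ with ∈-chords⁻ a (proj₁ L) (proj₁ R) c∈
      ... | inj₁ refl = subst (λ s → E (a , a + s)) (sym size≡) e
      ... | inj₂ (inj₁ c∈L) = proj₂ (proj₂ L) c∈L
      ... | inj₂ (inj₂ c∈R) = proj₂ (proj₂ R)
              (subst (λ s → c ∈ chords (a + s) (proj₁ R)) (proj₁ (proj₂ L)) c∈R)

-- Triangulations and trees

∈-vertices⁺ : ∀ {n v} → 1 ≤ v → v ≤ n → v ∈ vertices n
∈-vertices⁺ {v = suc v} _ v<n = ∈-applyUpTo⁺ suc v<n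

∈-vertices⁻ : ∀ {n v} → v ∈ vertices n → 1 ≤ v × v ≤ n
∈-vertices⁻ v∈ with ∈-applyUpTo⁻ suc v∈
... | _ , i<n , refl = s≤s z≤n , i<n

vertices-unique : ∀ n → Unique (vertices n)
vertices-unique n = Unique.applyUpTo⁺₁ suc n (λ i<j _ → ℕ.<⇒≢ (s<s i<j))

∈-diagonals⁺ : ∀ {n a b} → 1 ≤ a → b ≤ n → Diagonal n (a , b) → (a , b) ∈ diagonals n
∈-diagonals⁺ {n} 1≤a b≤n d@(a<b , _) = ∈-filter⁺ (diagonal? n)
  (∈-cartesianProduct⁺ (∈-vertices⁺ 1≤a (≤-trans (<⇒≤ a<b) b≤n))
                       (∈-vertices⁺ (≤-trans 1≤a (<⇒≤ a<b)) b≤n)) d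

∈-diagonals⁻ : ∀ {n a b} → (a , b) ∈ diagonals n → 1 ≤ a × b ≤ n × Diagonal n (a , b)
∈-diagonals⁻ {n} c∈ =
  let c∈′ , d = ∈-filter⁻ (diagonal? n) {xs = cartesianProduct (vertices n) (vertices n)} c∈
      a∈ , b∈ = ∈-cartesianProduct⁻ (vertices n) (vertices n) c∈′
  in proj₁ (∈-vertices⁻ a∈) , proj₂ (∈-vertices⁻ b∈) , d

diagonals-unique : ∀ n → Unique (diagonals n)
diagonals-unique n = Unique.filter⁺ (diagonal? n)
  (Unique.cartesianProduct⁺ (vertices-unique n) (vertices-unique n))

∈-triangles⁺ : ∀ {n T l j r} → 1 ≤ l → r ≤ n → IsTriangle n T (l , j , r) → (l , j , r) ∈ triangles n T
∈-triangles⁺ {n} {T} 1≤l r≤n τ@(l<j , j<r , _) = ∈-filter⁺ (isTriangle? n T)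
  (∈-cartesianProduct⁺ (∈-vertices⁺ 1≤l (≤-trans (<⇒≤ l<j) (≤-trans (<⇒≤ j<r) r≤n)))
    (∈-cartesianProduct⁺ (∈-vertices⁺ (≤-trans 1≤l (<⇒≤ l<j)) (≤-trans (<⇒≤ j<r) r≤n))
                         (∈-vertices⁺ (≤-trans 1≤l (≤-trans (<⇒≤ l<j) (<⇒≤ j<r))) r≤n))) τ

∈-triangles⁻ : ∀ {n T τ} → τ ∈ triangles n T → IsTriangle n T τ
∈-triangles⁻ {n} {T} τ∈ = proj₂ (∈-filter⁻ (isTriangle? n T)
  {xs = cartesianProduct (vertices n) (cartesianProduct (vertices n) (vertices n))} τ∈)

triangles-unique : ∀ n T → Unique (triangles n T)
triangles-unique n T = Unique.filter⁺ (isTriangle? n T)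
  (Unique.cartesianProduct⁺ (vertices-unique n)
    (Unique.cartesianProduct⁺ (vertices-unique n) (vertices-unique n)))

-- This separates the side `(1 , n)` from the steps: it is the root edge and is counted together
-- with the members of `T`.
long-edge : ∀ {n T a b} → suc a < b → Edge n T (a , b) → (a , b) ∈ (1 , n) ∷ T
long-edge a+1<b (inj₁ (inj₁ refl))          = contradiction a+1<b (n≮n _)
long-edge _     (inj₁ (inj₂ (refl , refl))) = here refl
long-edge _     (inj₂ c∈T)                  = there c∈T

step-edge : ∀ {n T} b → Edge n T (b , suc b)
step-edge b = inj₁ (inj₁ refl)

module _ {n : ℕ} {T : List Chord} (nonCrossing : AllPairs NonCrossing T)
         (bounded : ∀ {a b} → (a , b) ∈ T → 1 ≤ a × b ≤ n) where

  -- Sides cross nothing: a step has no vertex strictly between its ends, and `(1 , n)` has none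
  -- outside them.
  edges-nonCrossing : ∀ {c d} → Edge n T c → Edge n T d → ¬ Interleave c d
  edges-nonCrossing (inj₁ (inj₁ refl)) _ (p , q , _) = n≮n _ (<-≤-trans q p)
  edges-nonCrossing _ (inj₁ (inj₁ refl)) (_ , q , s) = n≮n _ (<-≤-trans s q)
  edges-nonCrossing (inj₁ (inj₂ (refl , refl))) (inj₁ (inj₂ (refl , refl))) (_ , _ , s) = n≮n _ s
  edges-nonCrossing (inj₁ (inj₂ (refl , refl))) (inj₂ d∈) (_ , _ , s) =
    n≮n _ (<-≤-trans s (proj₂ (bounded d∈)))
  edges-nonCrossing (inj₂ c∈) (inj₁ (inj₂ (refl , refl))) (p , _) =
    n≮n _ (<-≤-trans p (proj₁ (bounded c∈)))
  edges-nonCrossing (inj₂ c∈) (inj₂ d∈) i@(p , _) with ∈-AllPairs₂ nonCrossing c∈ d∈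
  ... | inj₁ refl       = n≮n _ p
  ... | inj₂ (inj₁ c#d) = c#d (inj₁ i)
  ... | inj₂ (inj₂ d#c) = d#c (inj₂ i)

  outer-unique : Unique (map outer (triangles n T))
  outer-unique = unique-map outer (triangles-unique n T) injective
    where
    injective : ∀ {τ σ} → τ ∈ triangles n T → σ ∈ triangles n T → outer τ ≡ outer σ → τ ≡ σ
    injective {l , j , r} {_ , j′ , _} τ∈ σ∈ refl =
      let l<j  , j<r  , lj  , jr  , _ = ∈-triangles⁻ {n} {T} τ∈
          l<j′ , j′<r , lj′ , j′r , _ = ∈-triangles⁻ {n} {T} σ∈
      in cong (λ i → l , i , r)
           (apex-unique step-edge edges-nonCrossing l<j j<r l<j′ j′<r lj jr lj′ j′r)

outer-⊆ : ∀ n T → map outer (triangles n T) ⊆ (1 , n) ∷ T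
outer-⊆ n T c∈ with ∈-map⁻ outer c∈
... | (l , j , r) , τ∈ , refl =
  let l<j , j<r , _ , _ , lr = ∈-triangles⁻ {n} {T} τ∈ in long-edge (≤-<-trans l<j j<r) lr

-- Filtering `diagonals n` yields the chords in the order that `subsets` prescribes, and drops the
-- root edge because it is a side.
treeDiagonals : ℕ → Tree → List Chord
treeDiagonals n t = filter (_∈? chords 1 t) (diagonals n)

module _ {n : ℕ} (3≤n : 3 ≤ n) (t : Tree) (nodes≡ : 2 + nodes t ≡ n) where
  private
    T = treeDiagonals n t

    size≡ : 1 + size t ≡ n
    size≡ = trans (cong suc (size≡1+nodes t)) nodes≡

    ∈T⇒∈diagonals : ∀ {c} → c ∈ T → c ∈ diagonals n
    ∈T⇒∈diagonals c∈ = proj₁ (∈-filter⁻ (_∈? chords 1 t) {xs = diagonals n} c∈)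

    ∈T⇒∈chords : ∀ {c} → c ∈ T → c ∈ chords 1 t
    ∈T⇒∈chords c∈ = proj₂ (∈-filter⁻ (_∈? chords 1 t) {xs = diagonals n} c∈)

    bounded : ∀ {a b} → (a , b) ∈ T → 1 ≤ a × b ≤ n
    bounded c∈ = let 1≤a , b≤n , _ = ∈-diagonals⁻ (∈T⇒∈diagonals c∈) in 1≤a , b≤n

  root∈chords : (1 , n) ∈ chords 1 t
  root∈chords = go t nodes≡ size≡
    where
    go : ∀ t → 2 + nodes t ≡ n → 1 + size t ≡ n → (1 , n) ∈ chords 1 t
    go leaf       nodes≡ _     = contradiction (subst (3 ≤_) (sym nodes≡) 3≤n) λ { (s≤s (s≤s ())) }
    go (node l r) _      size≡ = here (cong (1 ,_) (sym size≡))

  chords⊆ : chords 1 t ⊆ (1 , n) ∷ T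
  chords⊆ {c@(a , b)} c∈ with side? n c
  ... | yes s = long-edge (proj₁ (proj₂ (chords-span 1 t c∈))) (inj₁ s)
  ... | no ¬s = let 1≤a , a+1<b , b≤ = chords-span 1 t c∈ in
    there (∈-filter⁺ (_∈? chords 1 t)
      (∈-diagonals⁺ 1≤a (subst (b ≤_) size≡ b≤) (<-trans (n<1+n a) a+1<b , ¬s)) c∈)

  chords↭ : (1 , n) ∷ T ↭ chords 1 t
  chords↭ = ⊆∧⊇⇒↭ (All.tabulate root∉ ∷ Unique.filter⁺ (_∈? chords 1 t) (diagonals-unique n))
    (chords-unique 1 t) (λ { (here refl) → root∈chords ; (there c∈) → ∈T⇒∈chords c∈ }) chords⊆
    where
    root∉ : ∀ {c} → c ∈ T → (1 , n) ≢ c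
    root∉ c∈ refl = proj₂ (proj₂ (proj₂ (∈-diagonals⁻ {n} (∈T⇒∈diagonals c∈)))) (inj₂ (refl , refl))

  treeDiagonals-nonCrossing : AllPairs NonCrossing T
  treeDiagonals-nonCrossing = allPairs⁺ λ c∈ d∈ →
    [ chords-nonCrossing 1 t (∈T⇒∈chords c∈) (∈T⇒∈chords d∈)
    , chords-nonCrossing 1 t (∈T⇒∈chords d∈) (∈T⇒∈chords c∈) ]′

  1+length-treeDiagonals : 1 + length T ≡ nodes t
  1+length-treeDiagonals = trans (↭-length chords↭) (length-chords 1 t)

  chords⇒edges : ∀ {c} → c ∈ chords 1 t → Edge n T c
  chords⇒edges c∈ with chords⊆ c∈
  ... | here refl = inj₁ (inj₂ (refl , refl))
  ... | there c∈T = inj₂ c∈T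

  -- That there are no further triangles is a count: the outer edges of all triangles are distinct
  -- members of `(1 , n) ∷ T`, which has as many elements as `triples 1 t`.
  triples↭triangles : triples 1 t ↭ triangles n T
  triples↭triangles = ⊆∧length≥⇒↭ (triples-unique 1 t) triples⊆
    (subst₂ _≤_ (length-map outer (triangles n T))
      (trans 1+length-treeDiagonals (sym (length-triples 1 t)))
      (⊆⇒length≤ (outer-unique treeDiagonals-nonCrossing bounded) (outer-⊆ n T)))
    where
    triples⊆ : triples 1 t ⊆ triangles n T
    triples⊆ {l , j , r} τ∈ =
      let 1≤l , l<j , j<r , r≤ , lj , jr , lr = triples-edges step-edge 1 t chords⇒edges τ∈
      in ∈-triangles⁺ 1≤l (subst (r ≤_) size≡ r≤) (l<j , j<r , lj , jr , lr)

  treeDiagonals∈triangulations : T ∈ triangulations n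
  treeDiagonals∈triangulations = ∈-filter⁺ (isTriangulation? n)
    (filter-∈-subsets (_∈? chords 1 t) (diagonals n))
    ( cong (_∸ 3) (trans (cong (2 +_) 1+length-treeDiagonals) nodes≡) , treeDiagonals-nonCrossing
    , trans (sym (↭-length triples↭triangles)) (trans (length-triples 1 t) (cong (_∸ 2) nodes≡)))

-- The chords of both trees are edges of one and the same noncrossing set, so `tree-unique` applies.
treeDiagonals-injective : ∀ {n} → 3 ≤ n → ∀ t t′ → 2 + nodes t ≡ n → 2 + nodes t′ ≡ n →
                          treeDiagonals n t ≡ treeDiagonals n t′ → t ≡ t′
treeDiagonals-injective {n} 3≤n t t′ nodes≡ nodes≡′ T≡T′ =
  tree-unique step-edge
    (edges-nonCrossing (treeDiagonals-nonCrossing 3≤n t nodes≡) bounded)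
    1 t t′ (trans (size≡1+nodes t) (trans (suc-injective (trans nodes≡ (sym nodes≡′))) (sym (size≡1+nodes t′))))
    (chords⇒edges 3≤n t nodes≡)
    (λ {c} c∈ → subst (λ T → Edge n T c) (sym T≡T′) (chords⇒edges 3≤n t′ nodes≡′ c∈))
  where
  bounded : ∀ {a b} → (a , b) ∈ treeDiagonals n t → 1 ≤ a × b ≤ n
  bounded c∈ =
    let 1≤a , b≤n , _ = ∈-diagonals⁻ (proj₁ (∈-filter⁻ (_∈? chords 1 t) {xs = diagonals n} c∈))
    in 1≤a , b≤n

triangulation⇒tree : ∀ {n T} → 3 ≤ n → T ∈ triangulations n →
                     ∃ λ t → 2 + nodes t ≡ n × treeDiagonals n t ≡ T
triangulation⇒tree {n} {T} 3≤n T∈ = t , nodes≡ ,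
  filter-subset (_∈? chords 1 t) (diagonals-unique n) T∈subsets chords⇒T T⇒chords
  where
  T∈subsets = proj₁ (∈-filter⁻ (isTriangulation? n) {xs = subsets (diagonals n)} T∈)
  T! = proj₂ (∈-filter⁻ (isTriangulation? n) {xs = subsets (diagonals n)} T∈)

  T⊆diagonals : T ⊆ diagonals n
  T⊆diagonals = ∈-subsets⁻ (diagonals n) T∈subsets

  bounded : ∀ {a b} → (a , b) ∈ T → 1 ≤ a × b ≤ n
  bounded c∈ = let 1≤a , b≤n , _ = ∈-diagonals⁻ (T⊆diagonals c∈) in 1≤a , b≤n

  1+length≡ : 1 + length T ≡ n ∸ 2
  1+length≡ = trans (cong suc (proj₁ T!)) (sym (ℕ.+-∸-assoc 1 3≤n))

  outer↭ : map outer (triangles n T) ↭ (1 , n) ∷ T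
  outer↭ = ⊆∧length≥⇒↭ (outer-unique (proj₁ (proj₂ T!)) bounded) (outer-⊆ n T)
    (≤-reflexive (trans 1+length≡
      (sym (trans (length-map outer (triangles n T)) (proj₂ (proj₂ T!))))))

  apex : ∀ {l r} → suc l < r → Edge n T (l , r) →
         ∃ λ j → l < j × j < r × Edge n T (l , j) × Edge n T (j , r)
  apex l+1<r e with ∈-map⁻ outer (∈-resp-↭ (↭-sym outer↭) (long-edge l+1<r e))
  ... | (l , j , r) , τ∈ , refl =
    let l<j , j<r , lj , jr , _ = ∈-triangles⁻ {n} {T} τ∈ in j , l<j , j<r , lj , jr

  -- The root edge `(1 , n)` has length `suc (n ∸ 2)`, and the fuel has to exceed `n ∸ 2`.
  built = build step-edge (edges-nonCrossing (proj₁ (proj₂ T!)) bounded) apex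
            (1 + (n ∸ 2)) 1 (n ∸ 2) ≤-refl (inj₁ (inj₂ (refl , ℕ.m+[n∸m]≡n (<⇒≤ 3≤n))))
  t = proj₁ built

  nodes≡n∸2 : nodes t ≡ n ∸ 2
  nodes≡n∸2 = suc-injective (trans (sym (size≡1+nodes t)) (proj₁ (proj₂ built)))

  nodes≡ : 2 + nodes t ≡ n
  nodes≡ = trans (cong (2 +_) nodes≡n∸2) (ℕ.m+[n∸m]≡n (<⇒≤ 3≤n))

  chords⊆T : chords 1 t ⊆ (1 , n) ∷ T
  chords⊆T {a , b} c∈ = long-edge (proj₁ (proj₂ (chords-span 1 t c∈))) (proj₂ (proj₂ built) c∈)

  -- `build` only guarantees that the tree uses edges of `T`. That it uses every diagonal of `T`
  -- follows from the number of its nodes.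
  chords↭T : chords 1 t ↭ (1 , n) ∷ T
  chords↭T = ⊆∧length≥⇒↭ (chords-unique 1 t) chords⊆T
    (≤-reflexive (trans 1+length≡ (sym (trans (length-chords 1 t) nodes≡n∸2))))

  chords⇒T : ∀ {c} → c ∈ diagonals n → c ∈ chords 1 t → c ∈ T
  chords⇒T c∈ c∈chords with chords⊆T c∈chords
  ... | here refl = contradiction (inj₂ (refl , refl)) (proj₂ (proj₂ (proj₂ (∈-diagonals⁻ {n} c∈))))
  ... | there c∈T = c∈T

  T⇒chords : ∀ {c} → c ∈ T → c ∈ chords 1 t
  T⇒chords c∈ = ∈-resp-↭ (↭-sym chords↭T) (there c∈)

-- The left subtree starts at `a` again, whereas the right one starts beyond `a` and contributes
-- nothing, so the count runs down the left spine. `P` is arbitrary up to equivalence on members,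
-- because incidence with a vertex is defined as a disjunction over all corners.
count-triples : ∀ {p} {P : Pred Triangle p} (P? : Decidable P) a t →
                (∀ {τ} → τ ∈ triples a t → (P τ → proj₁ τ ≡ a) × (proj₁ τ ≡ a → P τ)) →
                length (filter P? (triples a t)) ≡ spine t
count-triples P? a leaf       _   = refl
count-triples P? a (node t u) P⇔ = trans
  (cong length (filter-accept P? (proj₂ (P⇔ (here refl)) refl)))
  (cong suc (trans (cong length (filter-++ P? (triples a t) _))
    (trans (length-++ (filter P? (triples a t)))
      (trans (cong₂ _+_ (count-triples P? a t (P⇔ ∘ there ∘ ∈-++⁺ˡ)) (cong length none))
        (+-identityʳ (spine t))))))
  where
  none : filter P? (triples (a + size t) u) ≡ []
  none = filter-none P? (All.tabulate λ τ∈ Pτ →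
    n≮n a (<-≤-trans (a<a+size a t)
      (subst (a + size t ≤_) (proj₁ (P⇔ (there (∈-++⁺ʳ (triples a t) τ∈))) Pτ)
        (proj₁ (chords-span (a + size t) u
          (subst (_ ∈_) (map-outer-triples (a + size t) u) (∈-map⁺ outer τ∈)))))))

length-filter-map : ∀ {a b p} {A : Set a} {B : Set b} {P : Pred B p} (P? : Decidable P) (f : A → B) xs →
                    length (filter P? (map f xs)) ≡ length (filter (P? ∘ f) xs)
length-filter-map P? f []       = refl
length-filter-map P? f (x ∷ xs) with P? (f x)
... | yes _ = cong suc (length-filter-map P? f xs)
... | no  _ = length-filter-map P? f xs

count-chords : ∀ {p} {P : Pred Chord p} (P? : Decidable P) a t →
               (∀ {c} → c ∈ chords a t → (P c → proj₁ c ≡ a) × (proj₁ c ≡ a → P c)) →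
               length (filter P? (chords a t)) ≡ spine t
count-chords P? a t P⇔ = trans
  (cong (length ∘ filter P?) (sym (map-outer-triples a t)))
  (trans (length-filter-map P? outer (triples a t))
    (count-triples (P? ∘ outer) a t λ τ∈ →
      P⇔ (subst (_ ∈_) (map-outer-triples a t) (∈-map⁺ outer τ∈))))

length-filter-↭ : ∀ {a p} {A : Set a} {P : Pred A p} (P? : Decidable P) {xs ys : List A} → xs ↭ ys →
                  length (filter P? xs) ≡ length (filter P? ys)
length-filter-↭ P? p = ↭-length (filter-↭ P? p)

module _ {n : ℕ} (3≤n : 3 ≤ n) (t : Tree) (nodes≡ : 2 + nodes t ≡ n) where
  private
    T = treeDiagonals n t

  -- Since 1 is the least index, it can only be the first corner of a triangle.
  𝒮-treeDiagonals : 𝒮 n T ≡ spine t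
  𝒮-treeDiagonals = trans (length-filter-↭ _ (↭-sym (triples↭triangles 3≤n t nodes≡)))
    (count-triples _ 1 t λ τ∈ →
      let 1≤l , l<j , j<r , _ = triples-edges {E = λ c → Edge n T c} step-edge 1 t (chords⇒edges 3≤n t nodes≡) τ∈
          1<j = ≤-<-trans 1≤l l<j
      in (λ { (inj₁ refl)        → refl
            ; (inj₂ (inj₁ refl)) → contradiction 1<j (n≮n 1)
            ; (inj₂ (inj₂ refl)) → contradiction (<-trans 1<j j<r) (n≮n 1) })
       , λ l≡1 → inj₁ (sym l≡1))

  -- The `suc` accounts for the root edge `(1 , n)`, which meets vertex 1 without being a diagonal.
  -- It is the source of the 1 in `𝒮≡𝒟₁+1`.
  count-treeDiagonals : ∀ {p} {P : Pred Chord p} (P? : Decidable P) →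
                        (∀ {c} → c ∈ chords 1 t → (P c → proj₁ c ≡ 1) × (proj₁ c ≡ 1 → P c)) →
                        suc (length (filter P? T)) ≡ spine t
  count-treeDiagonals P? P⇔ = trans
    (sym (cong length (filter-accept P? (proj₂ (P⇔ (root∈chords 3≤n t nodes≡)) refl))))
    (trans (length-filter-↭ P? (chords↭ 3≤n t nodes≡)) (count-chords P? 1 t P⇔))

  𝒟₁-treeDiagonals : suc (𝒟₁ T) ≡ spine t
  𝒟₁-treeDiagonals = count-treeDiagonals _ λ c∈ →
    let 1≤a , a+1<b , _ = chords-span 1 t c∈
    in (λ { (inj₁ refl) → refl
          ; (inj₂ refl) → contradiction (<-trans (s≤s 1≤a) a+1<b) (n≮n 1) })
     , λ l≡1 → inj₁ (sym l≡1)

-- Enumeration of trees by the length of the left spine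

forestNodes : ∀ {s} → Vec Tree s → ℕ
forestNodes []      = 0
forestNodes (t ∷ f) = nodes t + forestNodes f

rightSubtrees : ∀ t → Vec Tree (spine t)
rightSubtrees leaf       = []
rightSubtrees (node l r) = r ∷ rightSubtrees l

graft : ∀ {s} → Vec Tree s → Tree
graft []      = leaf
graft (t ∷ f) = node (graft f) t

graft-rightSubtrees : ∀ t → graft (rightSubtrees t) ≡ t
graft-rightSubtrees leaf       = refl
graft-rightSubtrees (node l r) = cong (λ l → node l r) (graft-rightSubtrees l)

graft-injective : ∀ {s} {f f′ : Vec Tree s} → graft f ≡ graft f′ → f ≡ f′
graft-injective {f = []}    {[]}     _  = refl
graft-injective {f = _ ∷ _} {_ ∷ _} eq with node-injective eq
  where
  node-injective : ∀ {l r l′ r′} → node l r ≡ node l′ r′ → l ≡ l′ × r ≡ r′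
  node-injective refl = refl , refl
... | l≡ , refl = cong (_ ∷_) (graft-injective l≡)

spine-graft : ∀ {s} (f : Vec Tree s) → spine (graft f) ≡ s
spine-graft []      = refl
spine-graft (_ ∷ f) = cong suc (spine-graft f)

nodes-graft : ∀ {s} (f : Vec Tree s) → nodes (graft f) ≡ s + forestNodes f
nodes-graft []          = refl
nodes-graft {suc s} (t ∷ f) = cong suc (trans (cong (_+ nodes t) (nodes-graft f))
  (trans (+-assoc s _ _) (cong (s +_) (+-comm (forestNodes f) (nodes t)))))

join : ∀ {s} → Vec Tree (2 + s) → Vec Tree (1 + s)
join (t ∷ u ∷ f) = node t u ∷ f

join-injective : ∀ {s} {f f′ : Vec Tree (2 + s)} → join f ≡ join f′ → f ≡ f′
join-injective {f = _ ∷ _ ∷ _} {_ ∷ _ ∷ _} refl = refl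

-- Opening the first tree removes one node but adds one tree, so the recursion descends
-- lexicographically, in `k` before `s`.
forests : ∀ s → ℕ → List (Vec Tree s)
forests zero    zero    = [] ∷ []
forests zero    (suc k) = []
forests (suc s) zero    = map (leaf ∷_) (forests s zero)
forests (suc s) (suc k) = map (leaf ∷_) (forests s (suc k)) ++ map join (forests (2 + s) k)

forests-unique : ∀ s k → Unique (forests s k)
forests-unique zero    zero    = [] ∷ []
forests-unique zero    (suc k) = []
forests-unique (suc s) zero    = Unique.map⁺ (λ { refl → refl }) (forests-unique s zero)
forests-unique (suc s) (suc k) = Unique.++⁺
  (Unique.map⁺ (λ { refl → refl }) (forests-unique s (suc k)))
  (Unique.map⁺ join-injective (forests-unique (2 + s) k))
  disjoint
  where
  disjoint : ∀ {f} → ¬ (f ∈ map (leaf ∷_) (forests s (suc k)) × f ∈ map join (forests (2 + s) k))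
  disjoint (f∈ , f∈′) with ∈-map⁻ (leaf ∷_) f∈ | ∈-map⁻ join f∈′
  ... | _ , _ , refl | _ ∷ _ ∷ _ , _ , ()

forests-nodes : ∀ s k → All (λ f → forestNodes f ≡ k) (forests s k)
forests-nodes zero    zero    = refl ∷ []
forests-nodes zero    (suc k) = []
forests-nodes (suc s) zero    = All.map⁺ (forests-nodes s zero)
forests-nodes (suc s) (suc k) = All.++⁺
  (All.map⁺ (forests-nodes s (suc k)))
  (All.map⁺ (All.map (λ {f} → nodes-join f) (forests-nodes (2 + s) k)))
  where
  nodes-join : (f : Vec Tree (2 + s)) → forestNodes f ≡ k → forestNodes (join f) ≡ suc k
  nodes-join (t ∷ u ∷ f) eq = cong suc (trans (+-assoc (nodes t) _ _) eq)

∈-forests⁺ : ∀ s k (f : Vec Tree s) → forestNodes f ≡ k → f ∈ forests s k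
∈-forests⁺ zero    zero    []             _  = here refl
∈-forests⁺ (suc s) zero    (leaf ∷ f)     eq = ∈-map⁺ (leaf ∷_) (∈-forests⁺ s zero f eq)
∈-forests⁺ (suc s) (suc k) (leaf ∷ f)     eq = ∈-++⁺ˡ (∈-map⁺ (leaf ∷_) (∈-forests⁺ s (suc k) f eq))
∈-forests⁺ (suc s) (suc k) (node t u ∷ f) eq = ∈-++⁺ʳ (map (leaf ∷_) (forests s (suc k)))
  (∈-map⁺ join (∈-forests⁺ (2 + s) k (t ∷ u ∷ f)
    (trans (sym (+-assoc (nodes t) _ _)) (suc-injective eq))))

-- The trees with i + k nodes whose left spine has length at least i.
treesFrom : ℕ → ℕ → List Tree
treesFrom i zero    = map graft (forests i zero)
treesFrom i (suc k) = map graft (forests i (suc k)) ++ treesFrom (suc i) k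

∈-graft-forests⁻ : ∀ i k {t} → t ∈ map graft (forests i k) → spine t ≡ i × nodes t ≡ i + k
∈-graft-forests⁻ i k t∈ with ∈-map⁻ graft t∈
... | f , f∈ , refl = spine-graft f , trans (nodes-graft f) (cong (i +_) (All.lookup (forests-nodes i k) f∈))

∈-graft-forests⁺ : ∀ k t → nodes t ≡ spine t + k → t ∈ map graft (forests (spine t) k)
∈-graft-forests⁺ k t nodes≡ = subst (_∈ map graft (forests (spine t) k)) (graft-rightSubtrees t)
  (∈-map⁺ graft (∈-forests⁺ (spine t) k (rightSubtrees t) (+-cancelˡ-≡ (spine t) _ _
    (trans (sym (nodes-graft (rightSubtrees t))) (trans (cong nodes (graft-rightSubtrees t)) nodes≡)))))

∈-treesFrom⁻ : ∀ i k {t} → t ∈ treesFrom i k → i ≤ spine t × nodes t ≡ i + k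
∈-treesFrom⁻ i zero    t∈ = let s≡ , n≡ = ∈-graft-forests⁻ i zero t∈ in ≤-reflexive (sym s≡) , n≡
∈-treesFrom⁻ i (suc k) t∈ with ∈-++⁻ (map graft (forests i (suc k))) t∈
... | inj₁ t∈ˡ = let s≡ , n≡ = ∈-graft-forests⁻ i (suc k) t∈ˡ in ≤-reflexive (sym s≡) , n≡
... | inj₂ t∈ʳ = let i< , n≡ = ∈-treesFrom⁻ (suc i) k t∈ʳ in <⇒≤ i< , trans n≡ (sym (+-suc i k))

∈-treesFrom⁺ : ∀ i k t → i ≤ spine t → nodes t ≡ i + k → t ∈ treesFrom i k
∈-treesFrom⁺ i k t i≤ n≡ with i ℕ.≟ spine t
∈-treesFrom⁺ i zero    t i≤ n≡ | yes refl = ∈-graft-forests⁺ zero t n≡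
∈-treesFrom⁺ i (suc k) t i≤ n≡ | yes refl = ∈-++⁺ˡ (∈-graft-forests⁺ (suc k) t n≡)
-- At `k = 0` every node lies on the spine: `i ≤ spine t ≤ nodes t = i`.
∈-treesFrom⁺ i zero    t i≤ n≡ | no i≢ = contradiction
  (≤-antisym i≤ (subst (spine t ≤_) (trans n≡ (+-identityʳ i)) (spine≤nodes t))) i≢
  where
  spine≤nodes : ∀ t → spine t ≤ nodes t
  spine≤nodes leaf       = z≤n
  spine≤nodes (node l r) = s≤s (≤-trans (spine≤nodes l) (m≤m+n (nodes l) (nodes r)))
∈-treesFrom⁺ i (suc k) t i≤ n≡ | no i≢ = ∈-++⁺ʳ (map graft (forests i (suc k)))
  (∈-treesFrom⁺ (suc i) k t (ℕ.≤∧≢⇒< i≤ i≢) (trans n≡ (+-suc i k)))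

treesFrom-unique : ∀ i k → Unique (treesFrom i k)
treesFrom-unique i zero    = Unique.map⁺ graft-injective (forests-unique i zero)
treesFrom-unique i (suc k) = Unique.++⁺
  (Unique.map⁺ graft-injective (forests-unique i (suc k))) (treesFrom-unique (suc i) k)
  λ (t∈ , t∈′) → n≮n i (subst (i <_) (proj₁ (∈-graft-forests⁻ i (suc k) t∈))
                                     (proj₁ (∈-treesFrom⁻ (suc i) k t∈′)))

-- For `3 ≤ n` a tree with `n ∸ 2` nodes is not a leaf, so its spine has length at least 1, and
-- `n ∸ 3` nodes remain.
trees : ℕ → List Tree
trees n = treesFrom 1 (n ∸ 3)

∈-trees⁻ : ∀ {n t} → 3 ≤ n → t ∈ trees n → 2 + nodes t ≡ n
∈-trees⁻ {n} 3≤n t∈ =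
  trans (cong (2 +_) (proj₂ (∈-treesFrom⁻ 1 (n ∸ 3) t∈))) (ℕ.m+[n∸m]≡n 3≤n)

∈-trees⁺ : ∀ {n t} → 3 ≤ n → 2 + nodes t ≡ n → t ∈ trees n
∈-trees⁺ {n} {t} 3≤n nodes≡ = ∈-treesFrom⁺ 1 (n ∸ 3) t (1≤spine t nodes≡)
  (ℕ.+-cancelˡ-≡ 2 _ _ (trans nodes≡ (sym (ℕ.m+[n∸m]≡n 3≤n))))
  where
  1≤spine : ∀ t → 2 + nodes t ≡ n → 1 ≤ spine t
  1≤spine leaf       nodes≡ = contradiction (subst (3 ≤_) (sym nodes≡) 3≤n) λ { (s≤s (s≤s ())) }
  1≤spine (node _ _) _      = s≤s z≤n

triangulations↭ : ∀ {n} → 3 ≤ n → triangulations n ↭ map (treeDiagonals n) (trees n)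
triangulations↭ {n} 3≤n = ⊆∧⊇⇒↭
  (Unique.filter⁺ (isTriangulation? n) (subsets-unique (diagonals-unique n)))
  (unique-map (treeDiagonals n) (treesFrom-unique 1 (n ∸ 3)) λ t∈ t′∈ →
    treeDiagonals-injective 3≤n _ _ (∈-trees⁻ 3≤n t∈) (∈-trees⁻ 3≤n t′∈))
  ⊆trees ⊇trees
  where
  ⊆trees : triangulations n ⊆ map (treeDiagonals n) (trees n)
  ⊆trees T∈ = let t , nodes≡ , T≡ = triangulation⇒tree 3≤n T∈ in
    subst (_∈ map (treeDiagonals n) (trees n)) T≡
      (∈-map⁺ (treeDiagonals n) (∈-trees⁺ {t = t} 3≤n nodes≡))

  ⊇trees : map (treeDiagonals n) (trees n) ⊆ triangulations n
  ⊇trees T∈ with ∈-map⁻ (treeDiagonals n) T∈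
  ... | t , t∈ , refl = treeDiagonals∈triangulations 3≤n t (∈-trees⁻ 3≤n t∈)

𝒮↭spine : ∀ {n} → 3 ≤ n → map (𝒮 n) (triangulations n) ↭ map spine (trees n)
𝒮↭spine {n} 3≤n = ↭-trans (map-↭ (𝒮 n) (triangulations↭ 3≤n))
  (↭-reflexive (trans (sym (map-∘ (trees n))) (map-cong-local (All.tabulate λ t∈ →
    𝒮-treeDiagonals 3≤n _ (∈-trees⁻ 3≤n t∈)))))

𝒮≡𝒟₁+1 : ∀ n → 3 ≤ n → ∀ T → T ∈ triangulations n → 𝒮 n T ≡ 𝒟₁ T + 1
𝒮≡𝒟₁+1 n 3≤n T T∈ = let t , nodes≡ , T≡ = triangulation⇒tree 3≤n T∈ in
  subst (λ T → 𝒮 n T ≡ 𝒟₁ T + 1) T≡ (trans (𝒮-treeDiagonals 3≤n t nodes≡)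
    (trans (sym (𝒟₁-treeDiagonals 3≤n t nodes≡)) (+-comm 1 (𝒟₁ (treeDiagonals n t)))))

-- Ballot numbers

-- For `s ≥ 1` this is `s / (2k + s)` times the binomial coefficient of `2k + s` over `k`, the
-- coefficient of `x^k` in the `s`-th power of the Catalan generating function.
ballot : ℕ → ℕ → ℕ
ballot zero    zero    = 1
ballot zero    (suc k) = 0
ballot (suc s) zero    = ballot s zero
ballot (suc s) (suc k) = ballot s (suc k) + ballot (2 + s) k

length-forests : ∀ s k → length (forests s k) ≡ ballot s k
length-forests zero    zero    = refl
length-forests zero    (suc k) = refl
length-forests (suc s) zero    = trans (length-map _ (forests s zero)) (length-forests s zero)
length-forests (suc s) (suc k) = trans (length-++ (map (leaf ∷_) (forests s (suc k)))) (cong₂ _+_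
  (trans (length-map _ (forests s (suc k))) (length-forests s (suc k)))
  (trans (length-map _ (forests (2 + s) k)) (length-forests (2 + s) k)))

-- Once the common factorials are cleared, the recurrence amounts to `(3 + k + s) (1 + s) + (1 + k)
-- (3 + s) = (2 + s) (3 + 2k + s)`.
ballot-factorial-step : ∀ s k P Q →
  P * (suc k ! * (suc k + suc s) !) ≡ suc s * (suc k + suc k + s) ! →
  Q * (k ! * (k + (3 + s)) !) ≡ (3 + s) * (k + k + (2 + s)) ! →
  (P + Q) * (suc k ! * (suc k + (2 + s)) !) ≡ (2 + s) * (suc k + suc k + suc s) !
ballot-factorial-step s k P Q eqP eqQ = begin
  (P + Q) * (suc k * k ! * (suc k + suc (suc s)) !)
    ≡⟨ cong (λ x → (P + Q) * (suc k * k ! * x)) G≡ ⟩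
  (P + Q) * (suc k * k ! * ((3 + k + s) * F))
    ≡⟨ regroup P Q (suc k) (k !) (3 + k + s) F ⟩
  (3 + k + s) * (P * (suc k * k ! * F)) + suc k * (Q * (k ! * ((3 + k + s) * F)))
    ≡⟨ cong₂ (λ x y → (3 + k + s) * x + suc k * y) IH₁ IH₂ ⟩
  (3 + k + s) * (suc s * H) + suc k * ((3 + s) * H)
    ≡⟨ factor s k H ⟩
  (2 + s) * (suc (suc k + suc k + s) * H)
    ≡⟨ cong ((2 + s) *_) (cong _! (sym (+-suc (suc k + suc k) s))) ⟩
  (2 + s) * (suc k + suc k + suc s) ! ∎
  where
  open ≡-Reasoning
  F = (2 + k + s) !
  H = (suc k + suc k + s) !

  G≡ : (suc k + suc (suc s)) ! ≡ (3 + k + s) * F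
  G≡ = cong _! (shift-index k s)
    where
    shift-index : ∀ k s → suc k + suc (suc s) ≡ 3 + k + s
    shift-index = solve-∀

  IH₁ : P * (suc k * k ! * F) ≡ suc s * H
  IH₁ = trans (cong (λ x → P * (suc k * k ! * x)) (cong _! (cong suc (sym (+-suc k s)))))
              eqP

  IH₂ : Q * (k ! * ((3 + k + s) * F)) ≡ (3 + s) * H
  IH₂ = trans (cong (λ x → Q * (k ! * x)) (cong _! (shift-index k s)))
          (trans eqQ (cong ((3 + s) *_) (cong _! (shift-index′ k s))))
    where
    shift-index : ∀ k s → 3 + k + s ≡ k + (3 + s)
    shift-index = solve-∀
    shift-index′ : ∀ k s → k + k + (2 + s) ≡ suc k + suc k + s
    shift-index′ = solve-∀

  regroup : ∀ p q c d e f →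
            (p + q) * (c * d * (e * f)) ≡ e * (p * (c * d * f)) + c * (q * (d * (e * f)))
  regroup = solve-∀
  factor : ∀ s k h → (3 + k + s) * (suc s * h) + suc k * ((3 + s) * h)
                   ≡ (2 + s) * (suc (suc k + suc k + s) * h)
  factor = solve-∀

-- The closed form is multiplied out to stay in the natural numbers, and indexed by `suc s` so that
-- no factorial has a subtraction in its argument.
ballot-factorial : ∀ s k → ballot (suc s) k * (k ! * (k + suc s) !) ≡ suc s * (k + k + s) !
ballot-factorial s       zero    = trans (cong (_* (1 * suc s !)) (ballot-zero s))
  (trans (ℕ.*-identityˡ _) (ℕ.*-identityˡ _))
  where
  ballot-zero : ∀ s → ballot (suc s) zero ≡ 1
  ballot-zero zero    = refl
  ballot-zero (suc s) = ballot-zero s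
-- `ballot 1 (suc k)` reduces to `ballot 2 k`: the other summand is `ballot 0 (suc k) = 0`, for
-- which there is no induction hypothesis.
ballot-factorial zero    (suc k) = begin
  ballot 2 k * (suc k * k ! * (suc k + 1) !)
    ≡⟨ cong (λ x → ballot 2 k * (suc k * k ! * x)) (cong _! (sym (+-suc k 1))) ⟩
  ballot 2 k * (suc k * k ! * (k + 2) !)        ≡⟨ regroup (ballot 2 k) (suc k) (k !) ((k + 2) !) ⟩
  suc k * (ballot 2 k * (k ! * (k + 2) !))      ≡⟨ cong (suc k *_) (ballot-factorial 1 k) ⟩
  suc k * (2 * (k + k + 1) !)                   ≡⟨ factor k ((k + k + 1) !) ⟩
  1 * (suc (k + k + 1) * (k + k + 1) !)         ≡⟨ cong (1 *_) (cong _! (shift-index k)) ⟩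
  1 * (suc k + suc k + 0) !                     ∎
  where
  open ≡-Reasoning
  regroup : ∀ b c d e → b * (c * d * e) ≡ c * (b * (d * e))
  regroup = solve-∀
  factor : ∀ k f → suc k * (2 * f) ≡ 1 * (suc (k + k + 1) * f)
  factor = solve-∀
  shift-index : ∀ k → suc (k + k + 1) ≡ suc k + suc k + 0
  shift-index = solve-∀
ballot-factorial (suc s) (suc k) = ballot-factorial-step s k (ballot (suc s) (suc k)) (ballot (3 + s) k)
  (ballot-factorial s (suc k)) (ballot-factorial (2 + s) k)

ballot₂-factorial : ∀ k → ballot 2 k * (k ! * (2 + k) !) ≡ 2 * (1 + k + k) !
ballot₂-factorial k = subst₂ (λ i j → ballot 2 k * (k ! * i !) ≡ 2 * j !)
  (+-comm k 2) (+-comm (k + k) 1) (ballot-factorial 1 k)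

factorials-nonZero : ∀ k → ℕ.NonZero (k ! * (2 + k) !)
factorials-nonZero k = k !* (2 + k) !≢0

-- The mean is the quotient of `ballot 3 k` by `ballot 2 k`; with `n = 3 + k` this reads
-- `3 (n - 2) / n`.
ballot₃-ballot₂ : ∀ k → ballot 3 k * (3 + k) ≡ 3 * suc k * ballot 2 k
ballot₃-ballot₂ k = ℕ.*-cancelʳ-≡ _ _ (k ! * (2 + k) !) {{factorials-nonZero k}} (begin
  ballot 3 k * (3 + k) * (k ! * (2 + k) !)     ≡⟨ regroup (ballot 3 k) (3 + k) (k !) ((2 + k) !) ⟩
  ballot 3 k * (k ! * (3 + k) !)               ≡⟨ cong (λ i → ballot 3 k * (k ! * i !)) (+-comm 3 k) ⟩
  ballot 3 k * (k ! * (k + 3) !)               ≡⟨ ballot-factorial 2 k ⟩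
  3 * (k + k + 2) !                            ≡⟨ cong (λ i → 3 * i !) (+-comm (k + k) 2) ⟩
  3 * ((2 + k + k) * (1 + k + k) !)            ≡⟨ factor k ((1 + k + k) !) ⟩
  3 * suc k * (2 * (1 + k + k) !)              ≡⟨ cong (3 * suc k *_) (ballot₂-factorial k) ⟨
  3 * suc k * (ballot 2 k * (k ! * (2 + k) !)) ≡⟨ ℕ.*-assoc (3 * suc k) (ballot 2 k) (k ! * (2 + k) !) ⟨
  3 * suc k * ballot 2 k * (k ! * (2 + k) !)   ∎)
  where
  open ≡-Reasoning
  regroup : ∀ b c d e → b * c * (d * e) ≡ b * (d * (c * e))
  regroup = solve-∀
  factor : ∀ k f → 3 * ((2 + k + k) * f) ≡ 3 * suc k * (2 * f)
  factor = solve-∀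

-- Twice the quotient of `ballot 4 k` by `ballot 2 k` is the mean of `𝒮 (𝒮 + 1)`, that is
-- `8 (n - 2) (2n - 3) / (n (n + 1))` for `n = 3 + k`.
ballot₄-ballot₂ : ∀ k → ballot 4 k * ((3 + k) * (4 + k)) ≡ 4 * suc k * (3 + k + k) * ballot 2 k
ballot₄-ballot₂ k = ℕ.*-cancelʳ-≡ _ _ (k ! * (2 + k) !) {{factorials-nonZero k}} (begin
  ballot 4 k * ((3 + k) * (4 + k)) * (k ! * (2 + k) !)
    ≡⟨ regroup (ballot 4 k) (3 + k) (4 + k) (k !) ((2 + k) !) ⟩
  ballot 4 k * (k ! * (4 + k) !)
    ≡⟨ cong (λ i → ballot 4 k * (k ! * i !)) (+-comm 4 k) ⟩
  ballot 4 k * (k ! * (k + 4) !)                           ≡⟨ ballot-factorial 3 k ⟩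
  4 * (k + k + 3) !                                        ≡⟨ cong (λ i → 4 * i !) (+-comm (k + k) 3) ⟩
  4 * ((3 + k + k) * ((2 + k + k) * (1 + k + k) !))        ≡⟨ factor k ((1 + k + k) !) ⟩
  4 * suc k * (3 + k + k) * (2 * (1 + k + k) !)
    ≡⟨ cong (4 * suc k * (3 + k + k) *_) (ballot₂-factorial k) ⟨
  4 * suc k * (3 + k + k) * (ballot 2 k * (k ! * (2 + k) !))
    ≡⟨ ℕ.*-assoc (4 * suc k * (3 + k + k)) (ballot 2 k) (k ! * (2 + k) !) ⟨
  4 * suc k * (3 + k + k) * ballot 2 k * (k ! * (2 + k) !) ∎)
  where
  open ≡-Reasoning
  regroup : ∀ b c c′ d e → b * (c * c′) * (d * e) ≡ b * (d * (c′ * (c * e)))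
  regroup = solve-∀
  factor : ∀ k f → 4 * ((3 + k + k) * ((2 + k + k) * f)) ≡ 4 * suc k * (3 + k + k) * (2 * f)
  factor = solve-∀

-- A pair of trees with `k` nodes in all is a nonempty tree with `suc k` nodes, so `ballot 2 k` is a
-- Catalan number of index `suc k`.
ballot₂-binomial : ∀ k → ballot 2 k * (2 + k) ≡ (2 * suc k) C suc k
ballot₂-binomial k = ℕ.*-cancelʳ-≡ _ _ (suc k ! * suc k !) {{suc k !* suc k !≢0}} (begin
  ballot 2 k * (2 + k) * (suc k ! * suc k !)  ≡⟨ regroup (ballot 2 k) (2 + k) (suc k) (k !) (suc k !) ⟩
  suc k * (ballot 2 k * (k ! * (2 + k) !))    ≡⟨ cong (suc k *_) (ballot₂-factorial k) ⟩
  suc k * (2 * (1 + k + k) !)                 ≡⟨ factor k ((1 + k + k) !) ⟩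
  (2 + k + k) * (1 + k + k) !                 ≡⟨ cong _! (shift-index k) ⟩
  (2 * suc k) !                               ≡⟨ m/n*n≡m {{nz}} (k![n∸k]!∣n! k+1≤) ⟨
  ((2 * suc k) ! ℕ./ (suc k ! * (2 * suc k ∸ suc k) !)) {{nz}} * (suc k ! * (2 * suc k ∸ suc k) !)
    ≡⟨ cong₂ (λ x i → x * (suc k ! * i !)) (nCk≡n!/k![n-k]! k+1≤) (sym half) ⟨
  ((2 * suc k) C suc k) * (suc k ! * suc k !)   ∎)
  where
  open ≡-Reasoning
  nz = suc k !* (2 * suc k ∸ suc k) !≢0
  k+1≤ : suc k ≤ 2 * suc k
  k+1≤ = m≤m+n (suc k) (1 * suc k)
  half : 2 * suc k ∸ suc k ≡ suc k
  half = trans (ℕ.m+n∸m≡n (suc k) (1 * suc k)) (ℕ.*-identityˡ (suc k))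
  regroup : ∀ b c d e f → b * c * (d * e * f) ≡ d * (b * (e * (c * f)))
  regroup = solve-∀
  factor : ∀ k f → suc k * (2 * f) ≡ (2 + k + k) * f
  factor = solve-∀
  shift-index : ∀ k → 2 + k + k ≡ 2 * suc k
  shift-index = solve-∀

-- Moments of the spine length

sum-graft-forests : ∀ (f : ℕ → ℕ) i k → sum (map (f ∘ spine) (map graft (forests i k))) ≡ ballot i k * f i
sum-graft-forests f i k = trans (go (forests i k)) (cong (_* f i) (length-forests i k))
  where
  go : ∀ vs → sum (map (f ∘ spine) (map graft vs)) ≡ length vs * f i
  go []       = refl
  go (v ∷ vs) = cong₂ _+_ (cong f (spine-graft v)) (go vs)

sum-treesFrom : ∀ (f : ℕ → ℕ) i k → sum (map (f ∘ spine) (treesFrom i (suc k)))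
              ≡ ballot i (suc k) * f i + sum (map (f ∘ spine) (treesFrom (suc i) k))
sum-treesFrom f i k = trans (cong sum (map-++ (f ∘ spine) (map graft (forests i (suc k))) _))
  (trans (sum-++ (map (f ∘ spine) (map graft (forests i (suc k)))) _)
    (cong₂ _+_ (sum-graft-forests f i (suc k)) refl))

length-treesFrom : ∀ i k → length (treesFrom i k) ≡ ballot (suc i) k
length-treesFrom i zero    = trans (length-map graft (forests i zero)) (length-forests i zero)
length-treesFrom i (suc k) = trans (length-++ (map graft (forests i (suc k)))) (cong₂ _+_
  (trans (length-map graft (forests i (suc k))) (length-forests i (suc k)))
  (length-treesFrom (suc i) k))

-- Writing each `s` as `i + (s - i)` gives `i` times the number of trees plus a sum of tail counts;
-- these are ballot numbers and telescope once more. The lower end is general for the induction, and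
-- the mean takes `i = 0`.
sum-spine : ∀ i k → sum (map spine (treesFrom (suc i) k)) ≡ i * ballot (2 + i) k + ballot (3 + i) k
sum-spine i zero = trans (sum-graft-forests (λ s → s) (suc i) zero) (factor i (ballot (suc i) zero))
  where
  factor : ∀ i b → b * suc i ≡ i * b + b
  factor = solve-∀
sum-spine i (suc k) = trans (sum-treesFrom (λ s → s) (suc i) k)
  (trans (cong (ballot (suc i) (suc k) * suc i +_) (sum-spine (suc i) k))
    (regroup i (ballot (suc i) (suc k)) (ballot (3 + i) k) (ballot (4 + i) k)))
  where
  regroup : ∀ i b c d → b * suc i + (suc i * c + d) ≡ i * (b + c) + (b + c + d)
  regroup = solve-∀

-- With s (s + 1) in place of s² the closed form needs no subtraction.
sum-spine[1+spine] : ∀ i k → sum (map (λ t → spine t * suc (spine t)) (treesFrom (suc i) k))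
  ≡ i * suc i * ballot (2 + i) k + 2 * i * ballot (3 + i) k + 2 * ballot (4 + i) k
sum-spine[1+spine] i zero = trans (sum-graft-forests (λ s → s * suc s) (suc i) zero) (factor i (ballot (suc i) zero))
  where
  factor : ∀ i b → b * (suc i * suc (suc i)) ≡ i * suc i * b + 2 * i * b + 2 * b
  factor = solve-∀
sum-spine[1+spine] i (suc k) = trans (sum-treesFrom (λ s → s * suc s) (suc i) k)
  (trans (cong (ballot (suc i) (suc k) * (suc i * suc (suc i)) +_) (sum-spine[1+spine] (suc i) k))
    (regroup i (ballot (suc i) (suc k)) (ballot (3 + i) k) (ballot (4 + i) k) (ballot (5 + i) k)))
  where
  regroup : ∀ i b c d e →
    b * (suc i * suc (suc i)) + (suc i * suc (suc i) * c + 2 * suc i * d + 2 * e)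
    ≡ i * suc i * (b + c) + 2 * i * (b + c + d) + 2 * (b + c + d + e)
  regroup = solve-∀

-- Rational arithmetic

open import Data.Integer.Base using (+_)

fromℤ : ℤ → ℚ
fromℤ i = i / 1

fromℕ : ℕ → ℚ
fromℕ n = + n / 1

-- Rationals are stored in lowest terms, and the gcd does not compute on variables. The equation is
-- therefore checked on unnormalised fractions.
fromℤ-+ : ∀ i j → fromℤ (i ℤ.+ j) ≡ fromℤ i ℚ.+ fromℤ j
fromℤ-+ i j = ℚ.toℚᵘ-injective (begin
  toℚᵘ (fromℤ (i ℤ.+ j))             ≈⟨ ℚ.toℚᵘ-fromℚᵘ (mkℚᵘ (i ℤ.+ j) 0) ⟩
  mkℚᵘ (i ℤ.+ j) 0                   ≈⟨ *≡* (factor i j) ⟩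
  mkℚᵘ i 0 ℚᵘ.+ mkℚᵘ j 0             ≈⟨ ℚᵘ.+-cong (ℚ.toℚᵘ-fromℚᵘ (mkℚᵘ i 0)) (ℚ.toℚᵘ-fromℚᵘ (mkℚᵘ j 0)) ⟨
  toℚᵘ (fromℤ i) ℚᵘ.+ toℚᵘ (fromℤ j) ≈⟨ ℚ.toℚᵘ-homo-+ (fromℤ i) (fromℤ j) ⟨
  toℚᵘ (fromℤ i ℚ.+ fromℤ j)         ∎)
  where
  open SetoidReasoning ℚᵘ.≃-setoid
  factor : ∀ i j → (i ℤ.+ j) ℤ.* (+ 1 ℤ.* + 1) ≡ (i ℤ.* + 1 ℤ.+ j ℤ.* + 1) ℤ.* + 1
  factor = ℤ-Solver.solve-∀

fromℤ-* : ∀ i j → fromℤ (i ℤ.* j) ≡ fromℤ i ℚ.* fromℤ j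
fromℤ-* i j = ℚ.toℚᵘ-injective (begin
  toℚᵘ (fromℤ (i ℤ.* j))             ≈⟨ ℚ.toℚᵘ-fromℚᵘ (mkℚᵘ (i ℤ.* j) 0) ⟩
  mkℚᵘ (i ℤ.* j) 0                   ≈⟨ *≡* refl ⟩
  mkℚᵘ i 0 ℚᵘ.* mkℚᵘ j 0             ≈⟨ ℚᵘ.*-cong (ℚ.toℚᵘ-fromℚᵘ (mkℚᵘ i 0)) (ℚ.toℚᵘ-fromℚᵘ (mkℚᵘ j 0)) ⟨
  toℚᵘ (fromℤ i) ℚᵘ.* toℚᵘ (fromℤ j) ≈⟨ ℚ.toℚᵘ-homo-* (fromℤ i) (fromℤ j) ⟨
  toℚᵘ (fromℤ i ℚ.* fromℤ j)         ∎)
  where open SetoidReasoning ℚᵘ.≃-setoid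

fromℤ-neg : ∀ i → fromℤ (ℤ.- i) ≡ ℚ.- fromℤ i
fromℤ-neg i = ℚ.toℚᵘ-injective (begin
  toℚᵘ (fromℤ (ℤ.- i)) ≈⟨ ℚ.toℚᵘ-fromℚᵘ (mkℚᵘ (ℤ.- i) 0) ⟩
  ℚᵘ.- mkℚᵘ i 0        ≈⟨ ℚᵘ.-‿cong (ℚ.toℚᵘ-fromℚᵘ (mkℚᵘ i 0)) ⟨
  ℚᵘ.- toℚᵘ (fromℤ i)  ≈⟨ ℚ.toℚᵘ-homo‿- (fromℤ i) ⟨
  toℚᵘ (ℚ.- fromℤ i)   ∎)
  where open SetoidReasoning ℚᵘ.≃-setoid

fromℤ-minus : ∀ i j → fromℤ (i ℤ.- j) ≡ fromℤ i ℚ.- fromℤ j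
fromℤ-minus i j = trans (fromℤ-+ i (ℤ.- j)) (cong (fromℤ i ℚ.+_) (fromℤ-neg j))

fromℕ-+ : ∀ m n → fromℕ (m + n) ≡ fromℕ m ℚ.+ fromℕ n
fromℕ-+ m n = fromℤ-+ (+ m) (+ n)

fromℕ-* : ∀ m n → fromℕ (m * n) ≡ fromℕ m ℚ.* fromℕ n
fromℕ-* m n = trans (cong fromℤ (ℤ.pos-* m n)) (fromℤ-* (+ m) (+ n))

/-*-cancel : ∀ i n .{{_ : NonZero n}} → (i / n) ℚ.* fromℕ n ≡ fromℤ i
/-*-cancel i n@(suc n-1) = ℚ.toℚᵘ-injective (begin
  toℚᵘ ((i / n) ℚ.* fromℕ n)         ≈⟨ ℚ.toℚᵘ-homo-* (i / n) (fromℕ n) ⟩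
  toℚᵘ (i / n) ℚᵘ.* toℚᵘ (fromℕ n)
    ≈⟨ ℚᵘ.*-cong (ℚ.toℚᵘ-fromℚᵘ (mkℚᵘ i n-1)) (ℚ.toℚᵘ-fromℚᵘ (mkℚᵘ (+ n) 0)) ⟩
  mkℚᵘ i n-1 ℚᵘ.* mkℚᵘ (+ n) 0
    ≈⟨ *≡* (trans (factor i (+ n)) (cong (λ d → i ℤ.* (+ d)) (sym (ℕ.*-identityʳ n)))) ⟩
  mkℚᵘ i 0                           ≈⟨ ℚ.toℚᵘ-fromℚᵘ (mkℚᵘ i 0) ⟨
  toℚᵘ (fromℤ i)                     ∎)
  where
  open SetoidReasoning ℚᵘ.≃-setoid
  factor : ∀ i n → i ℤ.* n ℤ.* + 1 ≡ i ℤ.* n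
  factor = ℤ-Solver.solve-∀

*-cancelʳ : ∀ p q n .{{_ : NonZero n}} → p ℚ.* fromℕ n ≡ q ℚ.* fromℕ n → p ≡ q
*-cancelʳ p q n eq = trans (sym (cancel p)) (trans (cong (ℚ._* (+ 1 / n)) eq) (cancel q))
  where
  open ≡-Reasoning
  cancel : ∀ p → p ℚ.* fromℕ n ℚ.* (+ 1 / n) ≡ p
  cancel p = begin
    p ℚ.* fromℕ n ℚ.* (+ 1 / n)   ≡⟨ ℚ.*-assoc p (fromℕ n) (+ 1 / n) ⟩
    p ℚ.* (fromℕ n ℚ.* (+ 1 / n))
      ≡⟨ cong (p ℚ.*_) (trans (ℚ.*-comm (fromℕ n) (+ 1 / n)) (/-*-cancel (+ 1) n)) ⟩
    p ℚ.* 1ℚ                      ≡⟨ ℚ.*-identityʳ p ⟩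
    p                             ∎

-- The closed forms are all proved with denominators cleared; this puts the fraction back.
≡-/ : ∀ p i n .{{_ : NonZero n}} → p ℚ.* fromℕ n ≡ fromℤ i → p ≡ i / n
≡-/ p i n eq = *-cancelʳ p (i / n) n (trans eq (sym (/-*-cancel i n)))

reciprocal-inverse : ∀ n .{{_ : NonZero n}} → reciprocal n ℚ.* fromℕ n ≡ 1ℚ
reciprocal-inverse n@(suc _) = /-*-cancel (+ 1) n

-- Sums with values in a commutative ℚ-algebra

module _ {c ℓ} (K : ℚ-Algebra c ℓ) where
  private module K = ℚ-Algebra K
  open RingMorphisms.IsRingHomomorphism K.fromℚ-homomorphism using (+-homo; 0#-homo; 1#-homo)

  ∑-++ : ∀ {a} {A : Set a} (f : A → K.Carrier) xs {ys} → K.∑ (xs ++ ys) f K.≈ K.∑ xs f K.+ K.∑ ys f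
  ∑-++ f []       = K.sym (K.+-identityˡ _)
  ∑-++ f (x ∷ xs) = K.trans (K.+-congˡ (∑-++ f xs)) (K.sym (K.+-assoc _ _ _))

  ∑-𝒮 : ∀ {n} → 3 ≤ n → (f : ℕ → K.Carrier) →
        K.∑ (triangulations n) (f ∘ 𝒮 n) K.≈ K.∑ (trees n) (f ∘ spine)
  ∑-𝒮 {n} 3≤n f = foldr-commMonoid K.setoid K.+-isCommutativeMonoid (↭⇒↭ₛ′ K.isEquivalence
    (subst₂ _↭_ (sym (map-∘ (triangulations n))) (sym (map-∘ (trees n))) (map-↭ f (𝒮↭spine 3≤n))))

  ∑-graft : ∀ (f : ℕ → K.Carrier) {i} (vs : List (Vec Tree i)) →
            K.∑ (map graft vs) (f ∘ spine) K.≈ fromℕ (length vs) K.• f i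
  ∑-graft f []           = K.sym (K.trans (K.*-congʳ 0#-homo) (K.zeroˡ _))
  ∑-graft f {i} (v ∷ vs) = begin
    f (spine (graft v)) K.+ K.∑ (map graft vs) (f ∘ spine)
      ≈⟨ K.+-cong (K.reflexive (cong f (spine-graft v))) (∑-graft f vs) ⟩
    f i K.+ fromℕ (length vs) K.• f i
      ≈⟨ K.+-congʳ (K.trans (K.*-congʳ 1#-homo) (K.*-identityˡ _)) ⟨
    1ℚ K.• f i K.+ fromℕ (length vs) K.• f i               ≈⟨ K.distribʳ _ _ _ ⟨
    (K.fromℚ 1ℚ K.+ K.fromℚ (fromℕ (length vs))) K.* f i   ≈⟨ K.*-congʳ (+-homo 1ℚ (fromℕ (length vs))) ⟨
    (1ℚ ℚ.+ fromℕ (length vs)) K.• f i                     ≡⟨ cong (K._• f i) (fromℕ-+ 1 (length vs)) ⟨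
    fromℕ (suc (length vs)) K.• f i                        ∎
    where open SetoidReasoning K.setoid

  -- `applyUpTo` passes from `h` to `h ∘ suc`, so the induction needs a variable `h`. The values of
  -- `q` are prescribed only for spine lengths that occur, since truncated subtraction spoils the
  -- coefficient formula elsewhere.
  ∑-treesFrom : ∀ (f : ℕ → K.Carrier) (q : ℕ → ℚ) i k (h : ℕ → ℕ) → (∀ j → h j ≡ suc i + j) →
                (∀ s j → s + j ≡ i + k → q (suc s) ≡ fromℕ (ballot (suc s) j)) →
                K.∑ (treesFrom (suc i) k) (f ∘ spine) K.≈ K.∑ (applyUpTo h (suc k)) (λ s → q s K.• f s)
  ∑-treesFrom f q i k h h≡ q≡ = go k h≡ q≡
    where
    first : ∀ k → h 0 ≡ suc i + 0 → q (suc i) ≡ fromℕ (ballot (suc i) k) →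
            K.∑ (map graft (forests (suc i) k)) (f ∘ spine) K.≈ q (h 0) K.• f (h 0)
    first k h₀≡ qi≡ = K.trans (∑-graft f (forests (suc i) k)) (K.reflexive (cong₂ (λ p s → p K.• f s)
      (trans (trans (cong fromℕ (length-forests (suc i) k)) (sym qi≡)) (cong q (sym h₀≡i)))
      (sym h₀≡i)))
      where h₀≡i = trans h₀≡ (+-identityʳ (suc i))

    go : ∀ k → (∀ j → h j ≡ suc i + j) →
         (∀ s j → s + j ≡ i + k → q (suc s) ≡ fromℕ (ballot (suc s) j)) →
         K.∑ (treesFrom (suc i) k) (f ∘ spine) K.≈ K.∑ (applyUpTo h (suc k)) (λ s → q s K.• f s)
    go zero    h≡ q≡ = K.trans (first zero (h≡ 0) (q≡ i zero refl)) (K.sym (K.+-identityʳ _))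
    go (suc k) h≡ q≡ = K.trans (∑-++ (f ∘ spine) (map graft (forests (suc i) (suc k))))
      (K.+-cong (first (suc k) (h≡ 0) (q≡ i (suc k) refl))
        (∑-treesFrom f q (suc i) k (h ∘ suc) (λ j → trans (h≡ (suc j)) (+-suc (suc i) j))
          (λ s j eq → q≡ s j (trans eq (sym (+-suc i k))))))

-- Mean and variance

private module Q = ℚ-Algebra ℚ-algebra

module _ {a} {A : Set a} (X : A → ℕ) where

  ∑-fromℕ : ∀ Ω → Q.∑ Ω (fromℕ ∘ X) ≡ fromℕ (sum (map X Ω))
  ∑-fromℕ []      = refl
  ∑-fromℕ (ω ∷ Ω) = trans (cong (fromℕ (X ω) ℚ.+_) (∑-fromℕ Ω)) (sym (fromℕ-+ (X ω) (sum (map X Ω))))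

  -- `μ` is arbitrary because the mean of a list is not that of its tail. The square of `X` enters
  -- as `X (X + 1) - X`, to match the second moment computed for spines.
  ∑-squaredDeviation : ∀ μ Ω → Q.∑ Ω (λ ω → (fromℕ (X ω) ℚ.- μ) ℚ.* (fromℕ (X ω) ℚ.- μ))
    ≡ fromℕ (sum (map (λ ω → X ω * suc (X ω)) Ω)) ℚ.- fromℕ (sum (map X Ω))
      ℚ.- fromℕ 2 ℚ.* μ ℚ.* fromℕ (sum (map X Ω)) ℚ.+ fromℕ (length Ω) ℚ.* (μ ℚ.* μ)
  ∑-squaredDeviation μ [] = solve 1 (λ μ → con 0ℚ := con 0ℚ :- con 0ℚ :- con (fromℕ 2) :* μ :* con 0ℚ
                                                     :+ con 0ℚ :* (μ :* μ)) refl μ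
    where open +-*-Solver
  ∑-squaredDeviation μ (ω ∷ Ω) = begin
    (x ℚ.- μ) ℚ.* (x ℚ.- μ) ℚ.+ Q.∑ Ω (λ ω → (fromℕ (X ω) ℚ.- μ) ℚ.* (fromℕ (X ω) ℚ.- μ))
      ≡⟨ cong ((x ℚ.- μ) ℚ.* (x ℚ.- μ) ℚ.+_) (∑-squaredDeviation μ Ω) ⟩
    (x ℚ.- μ) ℚ.* (x ℚ.- μ) ℚ.+ (b ℚ.- s ℚ.- fromℕ 2 ℚ.* μ ℚ.* s ℚ.+ l ℚ.* (μ ℚ.* μ))
      ≡⟨ solve 5 (λ x μ b s l →
           (x :- μ) :* (x :- μ) :+ (b :- s :- con (fromℕ 2) :* μ :* s :+ l :* (μ :* μ))
           := x :* (con 1ℚ :+ x) :+ b :- (x :+ s) :- con (fromℕ 2) :* μ :* (x :+ s) :+ (con 1ℚ :+ l) :* (μ :* μ))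
           refl x μ b s l ⟩
    x ℚ.* (1ℚ ℚ.+ x) ℚ.+ b ℚ.- (x ℚ.+ s) ℚ.- fromℕ 2 ℚ.* μ ℚ.* (x ℚ.+ s) ℚ.+ (1ℚ ℚ.+ l) ℚ.* (μ ℚ.* μ)
      ≡⟨ cong₂ (λ u v → u ℚ.+ v ℚ.* (μ ℚ.* μ))
           (cong₂ (λ u v → u ℚ.- v ℚ.- fromℕ 2 ℚ.* μ ℚ.* v) (sym b≡) (sym (fromℕ-+ (X ω) (sum (map X Ω)))))
           (sym (fromℕ-+ 1 (length Ω))) ⟩
    _ ∎
    where
    open ≡-Reasoning
    open +-*-Solver
    x = fromℕ (X ω)
    b = fromℕ (sum (map (λ ω → X ω * suc (X ω)) Ω))
    s = fromℕ (sum (map X Ω))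
    l = fromℕ (length Ω)
    b≡ : fromℕ (X ω * suc (X ω) + sum (map (λ ω → X ω * suc (X ω)) Ω)) ≡ x ℚ.* (1ℚ ℚ.+ x) ℚ.+ b
    b≡ = trans (fromℕ-+ (X ω * suc (X ω)) _)
      (cong (ℚ._+ b) (trans (fromℕ-* (X ω) (suc (X ω))) (cong (x ℚ.*_) (fromℕ-+ 1 (X ω)))))

  variance≡ : ∀ Ω .{{_ : NonZero (length Ω)}} → variance Ω X
    ≡ reciprocal (length Ω) ℚ.* fromℕ (sum (map (λ ω → X ω * suc (X ω)) Ω))
      ℚ.- mean Ω X ℚ.- mean Ω X ℚ.* mean Ω X
  variance≡ Ω = begin
    variance Ω X ≡⟨ cong (r ℚ.*_) (∑-squaredDeviation μ Ω) ⟩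
    r ℚ.* (b ℚ.- s ℚ.- fromℕ 2 ℚ.* μ ℚ.* s ℚ.+ l ℚ.* (μ ℚ.* μ))
      ≡⟨ solve 5 (λ r μ b s l →
           r :* (b :- s :- con (fromℕ 2) :* μ :* s :+ l :* (μ :* μ))
           := r :* b :- r :* s :- con (fromℕ 2) :* μ :* (r :* s) :+ r :* l :* (μ :* μ))
           refl r μ b s l ⟩
    r ℚ.* b ℚ.- r ℚ.* s ℚ.- fromℕ 2 ℚ.* μ ℚ.* (r ℚ.* s) ℚ.+ r ℚ.* l ℚ.* (μ ℚ.* μ)
      ≡⟨ cong₂ (λ u v → r ℚ.* b ℚ.- u ℚ.- fromℕ 2 ℚ.* μ ℚ.* u ℚ.+ v ℚ.* (μ ℚ.* μ))
           (cong (r ℚ.*_) (sym (∑-fromℕ Ω))) (reciprocal-inverse (length Ω)) ⟩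
    r ℚ.* b ℚ.- μ ℚ.- fromℕ 2 ℚ.* μ ℚ.* μ ℚ.+ 1ℚ ℚ.* (μ ℚ.* μ)
      ≡⟨ solve 2 (λ c μ → c :- μ :- con (fromℕ 2) :* μ :* μ :+ con 1ℚ :* (μ :* μ) := c :- μ :- μ :* μ)
           refl (r ℚ.* b) μ ⟩
    r ℚ.* b ℚ.- μ ℚ.- μ ℚ.* μ ∎
    where
    open ≡-Reasoning
    open +-*-Solver
    r = reciprocal (length Ω)
    μ = mean Ω X
    b = fromℕ (sum (map (λ ω → X ω * suc (X ω)) Ω))
    s = fromℕ (sum (map X Ω))
    l = fromℕ (length Ω)

-- Triangulations of the n-gon

module _ {n : ℕ} (3≤n : 3 ≤ n) where
  private
    k = n ∸ 3

    3+k≡n : 3 + k ≡ n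
    3+k≡n = ℕ.m+[n∸m]≡n 3≤n

    1+k≡n∸2 : suc k ≡ n ∸ 2
    1+k≡n∸2 = sym (ℕ.+-∸-assoc 1 3≤n)

    Ω = triangulations n
    N = length Ω
    y = fromℕ n

    y≡ : y ≡ fromℕ 3 ℚ.+ fromℕ k
    y≡ = trans (cong fromℕ (sym 3+k≡n)) (fromℕ-+ 3 k)

  length-triangulations : length (triangulations n) ≡ ballot 2 (n ∸ 3)
  length-triangulations = trans (↭-length (triangulations↭ 3≤n))
    (trans (length-map (treeDiagonals n) (trees n)) (length-treesFrom 1 k))

  ballot₂≡catalan : fromℕ (ballot 2 (n ∸ 3)) ≡ catalan (n ∸ 2)
  ballot₂≡catalan = subst (λ m → fromℕ (ballot 2 k) ≡ catalan m) 1+k≡n∸2 (begin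
    b                                                        ≡⟨ ℚ.*-identityʳ b ⟨
    b ℚ.* 1ℚ                                                 ≡⟨ cong (b ℚ.*_) (reciprocal-inverse (2 + k)) ⟨
    b ℚ.* (+ 1 / (2 + k) ℚ.* fromℕ (2 + k))
      ≡⟨ solve 3 (λ b c d → b :* (c :* d) := c :* (b :* d)) refl b (+ 1 / (2 + k)) (fromℕ (2 + k)) ⟩
    + 1 / (2 + k) ℚ.* (b ℚ.* fromℕ (2 + k))
      ≡⟨ cong (+ 1 / (2 + k) ℚ.*_) (fromℕ-* (ballot 2 k) (2 + k)) ⟨
    + 1 / (2 + k) ℚ.* fromℕ (ballot 2 k * (2 + k))
      ≡⟨ cong (λ c → + 1 / (2 + k) ℚ.* fromℕ c) (ballot₂-binomial k) ⟩
    catalan (suc k)                                          ∎)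
    where
    open ≡-Reasoning
    open +-*-Solver
    b = fromℕ (ballot 2 k)

  triangulations-nonZero : NonZero (length (triangulations n))
  triangulations-nonZero = subst NonZero (sym length-triangulations)
    (ℕ.m*n≢0⇒m≢0 (ballot 2 k) {{subst NonZero (sym (ballot₂-binomial k))
      (nCk-nonZero {2 * suc k} (m≤m+n (suc k) (1 * suc k)))}})

  private instance
    N≢0 : NonZero N
    N≢0 = triangulations-nonZero

  reciprocal≡1/catalan : reciprocal (length (triangulations n)) ≡ 1/catalan (n ∸ 2)
  reciprocal≡1/catalan = begin
    r                                   ≡⟨ ℚ.*-identityʳ r ⟨
    r ℚ.* 1ℚ
      ≡⟨ cong (r ℚ.*_) (ℚ.*-inverseʳ (catalan (n ∸ 2)) {{catalan-nonZero (n ∸ 2)}}) ⟨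
    r ℚ.* (catalan (n ∸ 2) ℚ.* c)       ≡⟨ ℚ.*-assoc r (catalan (n ∸ 2)) c ⟨
    r ℚ.* catalan (n ∸ 2) ℚ.* c
      ≡⟨ cong (λ b → r ℚ.* b ℚ.* c) (trans (cong fromℕ length-triangulations) ballot₂≡catalan) ⟨
    r ℚ.* fromℕ N ℚ.* c                 ≡⟨ cong (ℚ._* c) (reciprocal-inverse N) ⟩
    1ℚ ℚ.* c                            ≡⟨ ℚ.*-identityˡ c ⟩
    c                                   ∎
    where
    open ≡-Reasoning
    r = reciprocal N
    c = 1/catalan (n ∸ 2)

  -- With `n = 3 + s + j` the truncated differences are exact, namely `j`, `j + suc s` and
  -- `j + j + s`, and `ballot-factorial` applies.
  coefficient : ∀ s j → s + j ≡ n ∸ 3 →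
    ((+ (suc s * (2 * n ∸ suc s ∸ 5) !) / ((n ∸ suc s ∸ 2) ! * (n ∸ 2) !))
      {{(n ∸ suc s ∸ 2) !* (n ∸ 2) !≢0}}) ≡ fromℕ (ballot (suc s) j)
  coefficient s j s+j≡k = sym (≡-/ (fromℕ (ballot (suc s) j)) (+ (suc s * (2 * n ∸ suc s ∸ 5) !)) _ {{(n ∸ suc s ∸ 2) !* (n ∸ 2) !≢0}}
    (trans (sym (fromℕ-* (ballot (suc s) j) _)) (cong fromℕ (begin
      ballot (suc s) j * ((n ∸ suc s ∸ 2) ! * (n ∸ 2) !)
        ≡⟨ cong₂ (λ u v → ballot (suc s) j * (u ! * v !)) j≡ n∸2≡ ⟩
      ballot (suc s) j * (j ! * (j + suc s) !)  ≡⟨ ballot-factorial s j ⟩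
      suc s * (j + j + s) !                     ≡⟨ cong (λ u → suc s * u !) 2n≡ ⟨
      suc s * (2 * n ∸ suc s ∸ 5) !             ∎))))
    where
    open ≡-Reasoning
    n≡ : n ≡ 3 + (s + j)
    n≡ = trans (sym 3+k≡n) (cong (3 ℕ.+_) (sym s+j≡k))

    n∸2≡ : n ∸ 2 ≡ j + suc s
    n∸2≡ = trans (cong (_∸ 2) n≡) (shift-index s j)
      where
      shift-index : ∀ s j → suc (s + j) ≡ j + suc s
      shift-index = solve-∀

    j≡ : n ∸ suc s ∸ 2 ≡ j
    j≡ = trans (cong (λ n → n ∸ suc s ∸ 2) (trans n≡ (shift-index s j)))
               (cong (_∸ 2) (ℕ.m+n∸m≡n (suc s) (2 + j)))
      where
      shift-index : ∀ s j → 3 + (s + j) ≡ suc s + (2 + j)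
      shift-index = solve-∀

    2n≡ : 2 * n ∸ suc s ∸ 5 ≡ j + j + s
    2n≡ = trans (cong (λ n → 2 * n ∸ suc s ∸ 5) n≡)
      (trans (cong (λ m → m ∸ suc s ∸ 5) (shift-index s j))
             (cong (_∸ 5) (ℕ.m+n∸m≡n (suc s) (5 + (j + j + s)))))
      where
      shift-index : ∀ s j → 2 * (3 + (s + j)) ≡ suc s + (5 + (j + j + s))
      shift-index = solve-∀

  sum-𝒮 : ∀ (f : ℕ → ℕ) → sum (map (f ∘ 𝒮 n) (triangulations n)) ≡ sum (map (f ∘ spine) (trees n))
  sum-𝒮 f = trans (cong sum (map-∘ Ω))
    (trans (sum-↭ (map-↭ f (𝒮↭spine 3≤n))) (cong sum (sym (map-∘ (trees n)))))

  private
    r = reciprocal N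

    moment : ∀ b c → b ≡ c ℚ.* fromℕ N → r ℚ.* b ≡ c
    moment b c b≡ = trans (cong (r ℚ.*_) b≡)
      (trans (solve 3 (λ r c l → r :* (c :* l) := c :* (r :* l)) refl r c (fromℕ N))
        (trans (cong (c ℚ.*_) (reciprocal-inverse N)) (ℚ.*-identityʳ c)))
      where open +-*-Solver

  -- The denominator stays cleared so that `variance-𝒮` can substitute this for `μ * y`.
  mean-𝒮 : mean (triangulations n) (𝒮 n) ℚ.* fromℕ n ≡ fromℕ 3 ℚ.* (fromℕ n ℚ.- fromℕ 2)
  mean-𝒮 = begin
    r ℚ.* Q.∑ Ω (fromℕ ∘ 𝒮 n) ℚ.* y   ≡⟨ ℚ.*-assoc r _ y ⟩
    r ℚ.* (Q.∑ Ω (fromℕ ∘ 𝒮 n) ℚ.* y) ≡⟨ moment _ _ total ⟩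
    fromℕ 3 ℚ.* (y ℚ.- fromℕ 2)       ∎
    where
    open ≡-Reasoning
    open +-*-Solver
    total : Q.∑ Ω (fromℕ ∘ 𝒮 n) ℚ.* y ≡ fromℕ 3 ℚ.* (y ℚ.- fromℕ 2) ℚ.* fromℕ N
    total = begin
      Q.∑ Ω (fromℕ ∘ 𝒮 n) ℚ.* y
        ≡⟨ cong (ℚ._* y) (trans (∑-fromℕ (𝒮 n) Ω) (cong fromℕ (trans (sum-𝒮 (λ s → s)) (sum-spine 0 k)))) ⟩
      fromℕ (ballot 3 k) ℚ.* y                     ≡⟨ cong (λ m → fromℕ (ballot 3 k) ℚ.* fromℕ m) 3+k≡n ⟨
      fromℕ (ballot 3 k) ℚ.* fromℕ (3 + k)         ≡⟨ fromℕ-* (ballot 3 k) (3 + k) ⟨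
      fromℕ (ballot 3 k * (3 + k))                 ≡⟨ cong fromℕ (ballot₃-ballot₂ k) ⟩
      fromℕ (3 * suc k * ballot 2 k)               ≡⟨ fromℕ-* (3 * suc k) (ballot 2 k) ⟩
      fromℕ (3 * suc k) ℚ.* fromℕ (ballot 2 k)     ≡⟨ cong₂ ℚ._*_
          (trans (fromℕ-* 3 (suc k)) (cong (fromℕ 3 ℚ.*_) (fromℕ-+ 1 k)))
          (cong fromℕ (sym length-triangulations)) ⟩
      fromℕ 3 ℚ.* (1ℚ ℚ.+ fromℕ k) ℚ.* fromℕ N
        ≡⟨ solve 2 (λ k l → con (fromℕ 3) :* (con 1ℚ :+ k) :* l
                         := con (fromℕ 3) :* (con (fromℕ 3) :+ k :- con (fromℕ 2)) :* l) refl (fromℕ k) (fromℕ N) ⟩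
      fromℕ 3 ℚ.* (fromℕ 3 ℚ.+ fromℕ k ℚ.- fromℕ 2) ℚ.* fromℕ N
        ≡⟨ cong (λ y → fromℕ 3 ℚ.* (y ℚ.- fromℕ 2) ℚ.* fromℕ N) y≡ ⟨
      fromℕ 3 ℚ.* (y ℚ.- fromℕ 2) ℚ.* fromℕ N ∎

  mean-𝒮[1+𝒮] : reciprocal (length (triangulations n))
                  ℚ.* fromℕ (sum (map (λ T → 𝒮 n T * suc (𝒮 n T)) (triangulations n)))
                  ℚ.* (fromℕ n ℚ.* (1ℚ ℚ.+ fromℕ n))
                ≡ fromℕ 8 ℚ.* (fromℕ n ℚ.- fromℕ 2) ℚ.* (fromℕ 2 ℚ.* fromℕ n ℚ.- fromℕ 3)
  mean-𝒮[1+𝒮] = trans (ℚ.*-assoc r _ _) (moment _ _ (begin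
    fromℕ (sum (map (λ T → 𝒮 n T * suc (𝒮 n T)) Ω)) ℚ.* (y ℚ.* (1ℚ ℚ.+ y))
      ≡⟨ cong₂ ℚ._*_ (cong fromℕ (trans (sum-𝒮 (λ s → s * suc s)) (sum-spine[1+spine] 0 k))) yy≡ ⟩
    fromℕ (2 * ballot 4 k) ℚ.* fromℕ ((3 + k) * (4 + k)) ≡⟨ fromℕ-* (2 * ballot 4 k) ((3 + k) * (4 + k)) ⟨
    fromℕ (2 * ballot 4 k * ((3 + k) * (4 + k)))
      ≡⟨ cong fromℕ (trans (ℕ.*-assoc 2 (ballot 4 k) _) (cong (2 *_) (ballot₄-ballot₂ k))) ⟩
    fromℕ (2 * (4 * suc k * (3 + k + k) * ballot 2 k))
      ≡⟨ cong fromℕ (regroup k (ballot 2 k)) ⟩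
    fromℕ (8 * (1 + k) * (3 + (k + k)) * ballot 2 k)
      ≡⟨ trans (fromℕ-* (8 * (1 + k) * (3 + (k + k))) (ballot 2 k)) (cong₂ ℚ._*_
           (trans (fromℕ-* (8 * (1 + k)) (3 + (k + k))) (cong₂ ℚ._*_
             (trans (fromℕ-* 8 (1 + k)) (cong (fromℕ 8 ℚ.*_) (fromℕ-+ 1 k)))
             (trans (fromℕ-+ 3 (k + k)) (cong (fromℕ 3 ℚ.+_) (fromℕ-+ k k)))))
           (cong fromℕ (sym length-triangulations))) ⟩
    fromℕ 8 ℚ.* (1ℚ ℚ.+ fromℕ k) ℚ.* (fromℕ 3 ℚ.+ (fromℕ k ℚ.+ fromℕ k)) ℚ.* fromℕ N
      ≡⟨ solve 2 (λ k l → con (fromℕ 8) :* (con 1ℚ :+ k) :* (con (fromℕ 3) :+ (k :+ k)) :* l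
            := con (fromℕ 8) :* (con (fromℕ 3) :+ k :- con (fromℕ 2))
               :* (con (fromℕ 2) :* (con (fromℕ 3) :+ k) :- con (fromℕ 3)) :* l)
           refl (fromℕ k) (fromℕ N) ⟩
    fromℕ 8 ℚ.* (fromℕ 3 ℚ.+ fromℕ k ℚ.- fromℕ 2) ℚ.* (fromℕ 2 ℚ.* (fromℕ 3 ℚ.+ fromℕ k) ℚ.- fromℕ 3) ℚ.* fromℕ N
      ≡⟨ cong (λ y → fromℕ 8 ℚ.* (y ℚ.- fromℕ 2) ℚ.* (fromℕ 2 ℚ.* y ℚ.- fromℕ 3) ℚ.* fromℕ N) y≡ ⟨
    fromℕ 8 ℚ.* (y ℚ.- fromℕ 2) ℚ.* (fromℕ 2 ℚ.* y ℚ.- fromℕ 3) ℚ.* fromℕ N ∎))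
    where
    open ≡-Reasoning
    open +-*-Solver
    yy≡ : y ℚ.* (1ℚ ℚ.+ y) ≡ fromℕ ((3 + k) * (4 + k))
    yy≡ = trans (cong (y ℚ.*_) (sym (fromℕ-+ 1 n)))
      (trans (sym (fromℕ-* n (suc n))) (cong (λ n → fromℕ (n * suc n)) (sym 3+k≡n)))
    regroup : ∀ k b → 2 * (4 * suc k * (3 + k + k) * b) ≡ 8 * (1 + k) * (3 + (k + k)) * b
    regroup = solve-∀

  -- Multiplying by `y² (1 + y)` leaves the moments only in the products `c * (y * (1 + y))` and
  -- `μ * y`, both already known; what remains is a polynomial identity in `y`.
  variance-𝒮 : variance (triangulations n) (𝒮 n) ℚ.* (fromℕ n ℚ.* fromℕ n ℚ.* (1ℚ ℚ.+ fromℕ n))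
    ≡ fromℕ 2 ℚ.* (fromℕ 2 ℚ.* fromℕ n ℚ.- fromℕ 3) ℚ.* (fromℕ n ℚ.- fromℕ 2) ℚ.* (fromℕ n ℚ.- fromℕ 3)
  variance-𝒮 = begin
    variance Ω (𝒮 n) ℚ.* (y ℚ.* y ℚ.* (1ℚ ℚ.+ y))
      ≡⟨ cong (ℚ._* (y ℚ.* y ℚ.* (1ℚ ℚ.+ y))) (variance≡ (𝒮 n) Ω) ⟩
    (c ℚ.- μ ℚ.- μ ℚ.* μ) ℚ.* (y ℚ.* y ℚ.* (1ℚ ℚ.+ y))
      ≡⟨ solve 3 (λ c μ y → (c :- μ :- μ :* μ) :* (y :* y :* (con 1ℚ :+ y))
            := c :* (y :* (con 1ℚ :+ y)) :* y :- (μ :* y) :* y :* (con 1ℚ :+ y) :- (μ :* y) :* (μ :* y) :* (con 1ℚ :+ y))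
           refl c μ y ⟩
    c ℚ.* (y ℚ.* (1ℚ ℚ.+ y)) ℚ.* y ℚ.- (μ ℚ.* y) ℚ.* y ℚ.* (1ℚ ℚ.+ y) ℚ.- (μ ℚ.* y) ℚ.* (μ ℚ.* y) ℚ.* (1ℚ ℚ.+ y)
      ≡⟨ cong₂ (λ u v → u ℚ.* y ℚ.- v ℚ.* y ℚ.* (1ℚ ℚ.+ y) ℚ.- v ℚ.* v ℚ.* (1ℚ ℚ.+ y)) mean-𝒮[1+𝒮] mean-𝒮 ⟩
    _
      ≡⟨ solve 1 (λ y →
           con (fromℕ 8) :* (y :- con (fromℕ 2)) :* (con (fromℕ 2) :* y :- con (fromℕ 3)) :* y
           :- con (fromℕ 3) :* (y :- con (fromℕ 2)) :* y :* (con 1ℚ :+ y)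
           :- con (fromℕ 3) :* (y :- con (fromℕ 2)) :* (con (fromℕ 3) :* (y :- con (fromℕ 2))) :* (con 1ℚ :+ y)
           := con (fromℕ 2) :* (con (fromℕ 2) :* y :- con (fromℕ 3)) :* (y :- con (fromℕ 2)) :* (y :- con (fromℕ 3)))
           refl y ⟩
    fromℕ 2 ℚ.* (fromℕ 2 ℚ.* y ℚ.- fromℕ 3) ℚ.* (y ℚ.- fromℕ 2) ℚ.* (y ℚ.- fromℕ 3) ∎
    where
    open ≡-Reasoning
    open +-*-Solver
    μ = mean Ω (𝒮 n)
    c = reciprocal N ℚ.* fromℕ (sum (map (λ T → 𝒮 n T * suc (𝒮 n T)) Ω))

  generatingFunction : ∀ {c ℓ} (K : ℚ-Algebra c ℓ) → let open ℚ-Algebra K in (z : Carrier) →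
    g K n z ≈ 1/catalan (n ∸ 2) • ∑ (applyUpTo suc (n ∸ 2)) (λ s →
      (+ (s ℕ.* (2 ℕ.* n ∸ s ∸ 5) !) / ((n ∸ s ∸ 2) ! ℕ.* (n ∸ 2) !)) {{(n ∸ s ∸ 2) !* (n ∸ 2) !≢0}} • z ^ s)
  generatingFunction K z = K.*-cong (K.reflexive (cong K.fromℚ reciprocal≡1/catalan))
    (K.trans (∑-𝒮 K 3≤n (z K.^_))
      (subst (λ m → K.∑ (trees n) (λ t → z K.^ spine t) K.≈ K.∑ (applyUpTo suc m) (λ s → q s K.• z K.^ s)) 1+k≡n∸2
        (∑-treesFrom K (z K.^_) q 0 k suc (λ _ → refl) coefficient)))
    where
    module K = ℚ-Algebra K
    q : ℕ → ℚ
    q s = (+ (s * (2 * n ∸ s ∸ 5) !) / ((n ∸ s ∸ 2) ! * (n ∸ 2) !)) {{(n ∸ s ∸ 2) !* (n ∸ 2) !≢0}}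

-- Closed forms as fractions, and the degenerate polygon

mean-formula : ∀ n → .{{_ : NonZero n}} → 2 < n ⊎ 2 ≡ n →
               mean (triangulations n) (𝒮 n) ≡ (+ 3 ℤ.* (+ n ℤ.- + 2)) / n
mean-formula n (inj₁ 3≤n)  = ≡-/ _ (+ 3 ℤ.* (+ n ℤ.- + 2)) n (trans (mean-𝒮 3≤n)
  (sym (trans (fromℤ-* (+ 3) (+ n ℤ.- + 2)) (cong (fromℕ 3 ℚ.*_) (fromℤ-minus (+ n) (+ 2))))))
-- The correspondence with trees starts at `n = 3`, since for `n = 2` the root edge is a step that
-- bears no triangle. Here the single empty triangulation is evaluated, and both sides are 0.
mean-formula n (inj₂ refl) = refl

variance-formula : ∀ n → .{{_ : NonZero n}} → 2 < n ⊎ 2 ≡ n →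
  variance (triangulations n) (𝒮 n)
    ≡ ((+ 2 ℤ.* (+ 2 ℤ.* + n ℤ.- + 3) ℤ.* (+ n ℤ.- + 2) ℤ.* (+ n ℤ.- + 3)) / (n ℕ.^ 2 ℕ.* ℕ.suc n))
        {{m*n≢0 (n ℕ.^ 2) (ℕ.suc n) {{m^n≢0 n 2}}}}
variance-formula n (inj₂ refl) = refl
variance-formula n (inj₁ 3≤n)  = ≡-/ _ numerator _ {{m*n≢0 (n ℕ.^ 2) (suc n) {{m^n≢0 n 2}}}}
  (trans (cong (variance (triangulations n) (𝒮 n) ℚ.*_) denominator≡) (trans (variance-𝒮 3≤n) (sym numerator≡)))
  where
  numerator = + 2 ℤ.* (+ 2 ℤ.* + n ℤ.- + 3) ℤ.* (+ n ℤ.- + 2) ℤ.* (+ n ℤ.- + 3)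

  denominator≡ : fromℕ (n ℕ.^ 2 * suc n) ≡ fromℕ n ℚ.* fromℕ n ℚ.* (1ℚ ℚ.+ fromℕ n)
  denominator≡ = trans (fromℕ-* (n ℕ.^ 2) (suc n)) (cong₂ ℚ._*_
    (trans (cong (λ m → fromℕ (n * m)) (ℕ.*-identityʳ n)) (fromℕ-* n n)) (fromℕ-+ 1 n))

  numerator≡ : fromℤ numerator
    ≡ fromℕ 2 ℚ.* (fromℕ 2 ℚ.* fromℕ n ℚ.- fromℕ 3) ℚ.* (fromℕ n ℚ.- fromℕ 2) ℚ.* (fromℕ n ℚ.- fromℕ 3)
  numerator≡ = trans (fromℤ-* (+ 2 ℤ.* (+ 2 ℤ.* + n ℤ.- + 3) ℤ.* (+ n ℤ.- + 2)) (+ n ℤ.- + 3)) (cong₂ ℚ._*_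
    (trans (fromℤ-* (+ 2 ℤ.* (+ 2 ℤ.* + n ℤ.- + 3)) (+ n ℤ.- + 2)) (cong₂ ℚ._*_
      (trans (fromℤ-* (+ 2) (+ 2 ℤ.* + n ℤ.- + 3)) (cong (fromℕ 2 ℚ.*_)
        (trans (fromℤ-minus (+ 2 ℤ.* + n) (+ 3)) (cong (ℚ._- fromℕ 3) (fromℤ-* (+ 2) (+ n))))))
      (fromℤ-minus (+ n) (+ 2))))
    (fromℤ-minus (+ n) (+ 3)))

lemma5 : ∀ {c ℓ} (K : ℚ-Algebra c ℓ) → let open ℚ-Algebra K in
    (∀ n → 3 ≤ n → ∀ T → T ∈ triangulations n → 𝒮 n T ≡ 𝒟₁ T ℕ.+ 1)
    × (∀ n → 4 ≤ n → (z : Carrier) →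
    g K n z ≈ 1/catalan (n ∸ 2) •
    ∑ (applyUpTo ℕ.suc (n ∸ 2)) (λ s →
    (+ (s ℕ.* (2 ℕ.* n ∸ s ∸ 5) !) / ((n ∸ s ∸ 2) ! ℕ.* (n ∸ 2) !))
    {{(n ∸ s ∸ 2) !* (n ∸ 2) !≢0}} • z ^ s))
    × (∀ n → .{{_ : NonZero n}} → 2 ≤ n →
    mean (triangulations n) (𝒮 n) ≡ (+ 3 ℤ.* (+ n ℤ.- + 2)) / n)
    × (∀ n → .{{_ : NonZero n}} → 2 ≤ n →
    variance (triangulations n) (𝒮 n)
    ≡ ((+ 2 ℤ.* (+ 2 ℤ.* + n ℤ.- + 3) ℤ.* (+ n ℤ.- + 2) ℤ.* (+ n ℤ.- + 3)) / (n ℕ.^ 2 ℕ.* ℕ.suc n))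
    {{m*n≢0 (n ℕ.^ 2) (ℕ.suc n) {{m^n≢0 n 2}}}})
lemma5 K = 𝒮≡𝒟₁+1
         , (λ n 4≤n → generatingFunction (<⇒≤ 4≤n) K)
         , (λ n 2≤n → mean-formula n (ℕ.m≤n⇒m<n∨m≡n 2≤n))
         , (λ n 2≤n → variance-formula n (ℕ.m≤n⇒m<n∨m≡n 2≤n))
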